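{- Let $t\geq 4$ be an even integer and let $a,b,c\geq 1$ be integers with $a+b\geq t-1$. Put $v=a+b+c+1$ and let $L=\{1^a,2^b,t^c\}$, and suppose $t\leq \lfloor v/2\rfloor$. Then there exists a Hamiltonian path $H$ of $K_v$ with $\ell(H)=L$ if and only if the following condition holds: for every divisor $d$ of $v$, the number of elements of $L$ (counted with multiplicity) that are multiples of $d$ does not exceed $v-d$.
   Context: $K_v$ is the complete graph on the vertex set $\{0,1,\dots,v-1\}$. The length of an edge $[x,y]$ of $K_v$ is $\ell(x,y)=\min(|x-y|,\,v-|x-y|)$. For a subgraph $\Gamma$ of $K_v$, $\ell(\Gamma)$ is the multiset of lengths of all edges of $\Gamma$ (with multiplicity). The notation $\{1^{a},2^{b},t^{c}\}$ denotes the multiset consisting of $a$ copies of $1$, $b$ copies of $2$ and $c$ copies of $t$. (The paper phrases the claim as "$\mathrm{BHR}(\{1^a,2^b,t^c\})$ holds", where $\mathrm{BHR}(L)$, for a list $L$ of $v-1$ positive integers not exceeding $\lfloor v/2\rfloor$, is the assertion stated in the claim.) -}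

module Defs where

open import Data.Fin.Base using (Fin; toℕ)
open import Data.List.Base using (List; _++_; drop; filter; length; map; replicate; zip)
open import Data.List.Membership.Propositional using (_∈_)
open import Data.List.Relation.Unary.Unique.Propositional using (Unique)
open import Data.Nat.Base using (ℕ; _∸_; _⊓_; _≤_; ∣_-_∣)
open import Data.Nat.Divisibility using (_∣_; _∣?_)
open import Data.Product.Base using (_×_; uncurry)

-- An edge [x,y] of K_v is given by its endpoints in either order;
-- edgeLength is symmetric.
Edge : ℕ → Set
Edge v = Fin v × Fin v

edgeLength : ∀ {v} → Fin v → Fin v → ℕ
edgeLength {v} x y = ∣ toℕ x - toℕ y ∣ ⊓ (v ∸ ∣ toℕ x - toℕ y ∣)

-- Any two distinct vertices of K_v are adjacent, so a Hamiltonian path is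
-- exactly a sequence containing every vertex once; `unique` already makes
-- consecutive vertices distinct.
record HamiltonianPath (v : ℕ) : Set where
  field
    vertices : List (Fin v)
    unique   : Unique vertices
    spanning : ∀ x → x ∈ vertices

open HamiltonianPath public

edges : ∀ {v} → HamiltonianPath v → List (Edge v)
edges H = zip (vertices H) (drop 1 (vertices H))

-- Multisets are represented by lists, to be compared up to permutation (_↭_).
lengths : ∀ {v} → HamiltonianPath v → List ℕ
lengths H = map (uncurry edgeLength) (edges H)

-- The multiset {1^a, 2^b, t^c}.
multiset12t : (t a b c : ℕ) → List ℕ
multiset12t t a b c = replicate a 1 ++ replicate b 2 ++ replicate c t

-- Truncated subtraction is harmless for v ≥ 1, where d ∣ v gives d ≤ v.
DivisorCondition : ℕ → List ℕ → Set
DivisorCondition v L = ∀ d → d ∣ v → length (filter (d ∣?_) L) ≤ v ∸ d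

{-# OPTIONS --safe #-}
module Submission where

-- Under the hypotheses the divisor condition always holds: d = 2 needs only
-- a ≥ 1, and a divisor d ≥ 3 of v can only count the c copies of t, and only
-- if d ∣ t, in which case d ≤ t ≤ a + b + 1 = v − c.  So the content is that a
-- path always exists.
--
-- Every path constructed is linear: consecutive vertices, as integers, differ
-- by exactly 1, 2 or t, and such differences are lengths because 2t ≤ v.  The
-- interval [0, v) is laid out in rows of width t, so that edges of length t
-- run along columns, and columns are traversed alternately upwards and
-- downwards.  The first R = c mod t columns have one row more than the others;
-- passing between tall and short columns is cheap only along the bottom, and
-- passing from column t − 1 to column 0 only along the top.
--
-- A fork, i.e. two disjoint routes starting at 0 and 1 that cover [0, v), gives
-- a path at the cost of one more edge of length 1.  It also absorbs any number
-- of edges of length 2: put a new vertex below and attach it to the old vertex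
-- 1.  Hence it suffices to treat the smallest values of b.
--
-- For a = 1 (and for a = 2 with c even) even and odd vertices are covered
-- separately, each by the double of a route with edge lengths 1 and t / 2.  For
-- a ≥ 3 the columns are visited in zigzags 0, 2, 4, …, 5, 3, 1 within the tall
-- and within the short columns; for a ≥ t they are visited in order.

open import Defs
open import Data.Empty using (⊥-elim)
open import Data.Fin.Base using (Fin; toℕ; fromℕ<)
open import Data.Fin.Properties using (toℕ<n; toℕ-fromℕ<; toℕ-injective)
open import Data.List.Base using (List; []; _∷_; _++_; length; map; replicate; filter; zip; drop)
open import Data.List.Membership.Propositional using (_∈_)
open import Data.List.Membership.Propositional.Properties using (∈-map⁻)
open import Data.List.Properties using
  ( map-++; length-map; length-++; length-replicate; length-filter; filter-++; filter-none
  ; ∷-injectiveˡ; ∷-injectiveʳ)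
open import Data.List.Relation.Binary.Permutation.Propositional using
  (_↭_; prep; ↭-refl; ↭-sym; ↭-trans; ↭-reflexive; ↭⇒↭ₛ; module PermutationReasoning)
open import Data.List.Relation.Binary.Permutation.Propositional.Properties using
  ( ↭-length; ++⁺; ++⁺ˡ; ++⁺ʳ; ++-assoc; ++-comm; ∷↭∷ʳ; map⁺; All-resp-↭; ∈-resp-↭
  ; ++-commutativeMonoid) renaming (shift to ↭-shift)
open import Data.List.Relation.Binary.Permutation.Setoid.Properties using (Unique-resp-↭)
open import Data.List.Relation.Unary.All using (All; []; _∷_)
import Data.List.Relation.Unary.All as All
import Data.List.Relation.Unary.All.Properties as All
open import Data.List.Relation.Unary.AllPairs using ([]; _∷_)
open import Data.List.Relation.Unary.Any using (here; there)
open import Data.List.Relation.Unary.Unique.Propositional using (Unique)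
import Data.List.Relation.Unary.Unique.Propositional.Properties as Unique
open import Data.Nat.Base hiding (parity)
open import Data.Nat.Divisibility using (_∣_; _∣?_; divides; ∣⇒≤; >⇒∤)
open import Data.Nat.DivMod using (_divMod_; result)
open import Data.Nat.Properties
open import Data.Nat.Tactic.RingSolver using (solve-∀)
open import Data.Product.Base using (_×_; _,_; ∃-syntax; proj₂; uncurry)
open import Function.Bundles using (_⇔_; mk⇔)
open import Relation.Binary.PropositionalEquality using
  (_≡_; refl; sym; trans; cong; cong₂; subst; subst₂; setoid)
open import Relation.Nullary using (¬_; yes; no)

open import Algebra.Solver.CommutativeMonoid (++-commutativeMonoid {A = ℕ})
  using (_⊕_; _⊜_) renaming (solve to permute)

-- Walks

data Adj (d x y : ℕ) : Set where
  up   : d + x ≡ y → Adj d x y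
  down : d + y ≡ x → Adj d x y

Adj-sym : ∀ {d x y} → Adj d x y → Adj d y x
Adj-sym (up p) = down p
Adj-sym (down p) = up p

+-exchange : ∀ d k x → d + (k + x) ≡ k + (d + x)
+-exchange = solve-∀

Adj-shift : ∀ k {d x y} → Adj d x y → Adj d (k + x) (k + y)
Adj-shift k {d} {x}     (up refl)   = up (+-exchange d k x)
Adj-shift k {d} {x} {y} (down refl) = down (+-exchange d k y)

-- `D d a b`: an edge of length d is allowed and counts as a edges of
-- length 1 and b edges of length 2.
Cost : Set₁
Cost = ℕ → ℕ → ℕ → Set

-- Edges of length t are left uncounted: their number follows from the number of vertices and the
-- other two counts.
data Walk (D : Cost) : ℕ → ℕ → ℕ → ℕ → Set where
  stop : ∀ x → Walk D x x 0 0
  step : ∀ {d x y z a b a′ b′} → D d a b → Adj d x y → Walk D y z a′ b′ →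
         Walk D x z (a + a′) (b + b′)

verts : ∀ {D x y a b} → Walk D x y a b → List ℕ
verts (stop x)             = x ∷ []
verts (step {x = x} _ _ w) = x ∷ verts w

-- Covering up to permutation expresses disjointness and spanning at once: a route over `range 0 v`
-- visits every vertex below v exactly once.
record Route (D : Cost) (x y : ℕ) (vs : List ℕ) (a b : ℕ) : Set where
  constructor route
  field
    walk   : Walk D x y a b
    covers : verts walk ↭ vs

open Route public

module _ {D : Cost} where

  from : ∀ {x x′ y vs a b} → x ≡ x′ → Route D x y vs a b → Route D x′ y vs a b
  from refl r = r

  to : ∀ {x y y′ vs a b} → y ≡ y′ → Route D x y vs a b → Route D x y′ vs a b
  to refl r = r

  recount : ∀ {x y vs a a′ b b′} → Route D x y vs a b → a ≡ a′ → b ≡ b′ → Route D x y vs a′ b′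
  recount r refl refl = r

  recover : ∀ {x y vs vs′ a b} → vs ↭ vs′ → Route D x y vs a b → Route D x y vs′ a b
  recover p (route w q) = route w (↭-trans q p)

  single : ∀ x → Route D x x (x ∷ []) 0 0
  single x = route (stop x) ↭-refl

  private
    append : ∀ {d x y z u a b a₁ b₁ a₂ b₂} → D d a b → Adj d y z →
             (w : Walk D x y a₁ b₁) (w′ : Walk D z u a₂ b₂) →
             Route D x u (verts w ++ verts w′) (a₁ + (a + a₂)) (b₁ + (b + b₂))
    append e p (stop x) w′ = route (step e p w′) ↭-refl
    append e p (step {a = a} {b} {a′} {b′} f q w) w′ =
      let r = append e p w w′ in
      recount (route (step f q (walk r)) (prep _ (covers r)))
        (sym (+-assoc a a′ _)) (sym (+-assoc b b′ _))

  link : ∀ {d x y z u vs us a b a₁ b₁ a₂ b₂} → D d a b → Adj d y z →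
         Route D x y vs a₁ b₁ → Route D z u us a₂ b₂ →
         Route D x u (vs ++ us) (a₁ + (a + a₂)) (b₁ + (b + b₂))
  link e y~z (route w p) (route w′ q) = recover (++⁺ p q) (append e y~z w w′)

  reverse : ∀ {x y vs a b} → Route D x y vs a b → Route D y x vs a b
  reverse (route w p) = recover p (go w)
    where
    go : ∀ {x y a b} (w : Walk D x y a b) → Route D y x (verts w) a b
    go (stop x) = single x
    go (step {x = x} {a = a} {b} {a′} {b′} e p w) =
      recover (↭-sym (∷↭∷ʳ x (verts w)))
        (recount (link e (Adj-sym p) (go w) (single x))
          (swap a a′) (swap b b′))
      where
      swap : ∀ m n → n + (m + 0) ≡ m + n
      swap = solve-∀

  translate : ∀ k {x y vs a b} → Route D x y vs a b → Route D (k + x) (k + y) (map (k +_) vs) a b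
  translate k (route w p) = recover (map⁺ (k +_) p) (go w)
    where
    go : ∀ {x y a b} (w : Walk D x y a b) → Route D (k + x) (k + y) (map (k +_) (verts w)) a b
    go (stop x) = single (k + x)
    go (step e p w) = let r = go w in route (step e (Adj-shift k p) (walk r)) (prep _ (covers r))

widen : ∀ {D D′ : Cost} → (∀ {d a b} → D d a b → D′ d a b) →
        ∀ {x y vs a b} → Route D x y vs a b → Route D′ x y vs a b
widen {D} {D′} inc (route w p) = recover p (go w)
  where
  go : ∀ {x y a b} (w : Walk D x y a b) → Route D′ x y (verts w) a b
  go (stop x) = single x
  go (step e p w) = let r = go w in route (step (inc e) p (walk r)) (prep _ (covers r))

data Short : Cost where
  one : Short 1 1 0
  two : Short 2 0 1

data Long (t : ℕ) : Cost where
  short : ∀ {d a b} → Short d a b → Long t d a b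
  tee   : Long t t 0 0

-- The half-scale picture: `double` turns the lengths 1 and s into 2 and s * 2. At full scale, s =
-- t, these are the edges of `Long t` other than those of length 2.
data Scaled (s : ℕ) : Cost where
  one : Scaled s 1 1 0
  tee : Scaled s s 0 0

Scaled⊆Long : ∀ {t d a b} → Scaled t d a b → Long t d a b
Scaled⊆Long one = short one
Scaled⊆Long tee = tee

affine : ℕ → ℕ → ℕ
affine k x = k + x * 2

double : ∀ k {s x y vs a b} → Route (Scaled s) x y vs a b →
         Route (Long (s * 2)) (affine k x) (affine k y) (map (affine k) vs) b a
double k {s} (route w p) = recover (map⁺ (affine k) p) (go w)
  where
  cost : ∀ {d a b} → Scaled s d a b → Long (s * 2) (d * 2) b a
  cost one = short two
  cost tee = tee

  distrib : ∀ d k x → d * 2 + (k + x * 2) ≡ k + (d + x) * 2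
  distrib = solve-∀

  adj : ∀ {d x y} → Adj d x y → Adj (d * 2) (affine k x) (affine k y)
  adj {d} {x}     (up refl)   = up (distrib d k x)
  adj {d} {x} {y} (down refl) = down (distrib d k y)

  go : ∀ {x y a b} (w : Walk (Scaled s) x y a b) →
       Route (Long (s * 2)) (affine k x) (affine k y) (map (affine k) (verts w)) b a
  go (stop x) = single _
  go (step e p w) = let r = go w in route (step (cost e) (adj p) (walk r)) (prep _ (covers r))

-- Intervals of integers as lists

range : ℕ → ℕ → List ℕ
range k zero    = []
range k (suc n) = k ∷ range (suc k) n

length-range : ∀ k n → length (range k n) ≡ n
length-range k zero    = refl
length-range k (suc n) = cong suc (length-range (suc k) n)

range-++ : ∀ k m n → range k (m + n) ≡ range k m ++ range (m + k) n
range-++ k zero    n = refl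
range-++ k (suc m) n =
  cong (k ∷_) (trans (range-++ (suc k) m n) (cong (λ j → range (suc k) m ++ range j n) (+-suc m k)))

range-snoc : ∀ k n → range k n ++ (n + k ∷ []) ≡ range k (suc n)
range-snoc k n = trans (sym (range-++ k n 1)) (cong (range k) (+-comm n 1))

range-snoc₀ : ∀ n → range 0 n ++ (n ∷ []) ≡ range 0 (suc n)
range-snoc₀ n = trans (cong (λ i → range 0 n ++ (i ∷ [])) (sym (+-identityʳ n))) (range-snoc 0 n)

range-∷ʳ : ∀ k n → n + k ∷ range k n ↭ range k (suc n)
range-∷ʳ k n = ↭-trans (∷↭∷ʳ (n + k) (range k n)) (↭-reflexive (range-snoc k n))

map-range : ∀ j k n → map (j +_) (range k n) ≡ range (j + k) n
map-range j k zero    = refl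
map-range j k (suc n) =
    cong (j + k ∷_) (trans (map-range j (suc k) n) (cong (λ i → range i n) (+-suc j k)))

affine-interleave : ∀ k m n → map (affine k) (range m n) ++ map (affine (suc k)) (range m n) ↭
                    range (affine k m) (n * 2)
affine-interleave k m zero    = ↭-refl
affine-interleave k m (suc n) = prep _ (↭-trans (↭-shift _ (map (affine k) (range (suc m) n)) _)
  (prep _ (↭-trans (affine-interleave k (suc m) n)
    (↭-reflexive (cong (λ i → range i (n * 2)) (trans (+-suc k _) (cong suc (+-suc k _))))))))

-- Columns and staircases

-- The end of a column at which a route stands. Traversing a column changes it, so after m columns
-- it is `opposite^ m`.
data Side : Set where
  low high : Side

opposite : Side → Side
opposite low  = high
opposite high = low

opposite^ : ℕ → Side → Side
opposite^ zero    s = s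
opposite^ (suc n) s = opposite^ n (opposite s)

opposite^-even : ∀ m s → opposite^ (m * 2) s ≡ s
opposite^-even zero    s    = refl
opposite^-even (suc m) low  = opposite^-even m low
opposite^-even (suc m) high = opposite^-even m high

module Grid (w : ℕ) where

  at : Side → ℕ → ℕ → ℕ
  at low  n x = x
  at high n x = n * w + x

  -- n + 1 rows: each column carries n edges of length w.
  rect : ℕ → List ℕ → List ℕ
  rect zero    xs = xs
  rect (suc n) xs = xs ++ rect n (map (w +_) xs)

  rect-[] : ∀ n → rect n [] ≡ []
  rect-[] zero    = refl
  rect-[] (suc n) = rect-[] n

  rect-++ : ∀ n xs ys → rect n (xs ++ ys) ↭ rect n xs ++ rect n ys
  rect-++ zero    xs ys = ↭-refl
  rect-++ (suc n) xs ys = ↭-trans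
    (++⁺ˡ (xs ++ ys) (↭-trans (↭-reflexive (cong (rect n) (map-++ (w +_) xs ys))) (rect-++ n _ _)))
    (permute 4 (λ x y x′ y′ → (x ⊕ y) ⊕ (x′ ⊕ y′) ⊜ (x ⊕ x′) ⊕ (y ⊕ y′)) ↭-refl
       xs ys (rect n (map (w +_) xs)) (rect n (map (w +_) ys)))

  rect-↭ : ∀ n {xs ys} → xs ↭ ys → rect n xs ↭ rect n ys
  rect-↭ zero    p = p
  rect-↭ (suc n) p = ++⁺ p (rect-↭ n (map⁺ (w +_) p))

  rect-top : ∀ n x → rect (suc n) (x ∷ []) ↭ rect n (x ∷ []) ++ (suc n * w + x ∷ [])
  rect-top zero    x = ↭-reflexive (cong (λ y → x ∷ y + x ∷ []) (sym (+-identityʳ w)))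
  rect-top (suc n) x = prep x (↭-trans (rect-top n (w + x))
    (++⁺ˡ (rect n (w + x ∷ [])) (↭-reflexive (cong (_∷ []) (shift (n * w) w x)))))
    where
    shift : ∀ nw w x → w + nw + (w + x) ≡ w + (w + nw) + x
    shift = solve-∀

  -- The interval consists of h + 1 full rows of width w and R further vertices, which sit on top of
  -- the first R columns. The induction removes the bottom row.
  grid : ∀ h k R M → w ≡ R + M →
         rect (suc h) (range k R) ++ rect h (range (R + k) M) ↭ range k (suc h * w + R)
  grid zero k R M refl = begin
    (range k R ++ map (w +_) (range k R)) ++ range (R + k) M
      ≡⟨ cong (λ xs → (range k R ++ xs) ++ range (R + k) M) (map-range w k R) ⟩
    (range k R ++ range (w + k) R) ++ range (R + k) M
      ↭⟨ permute 3 (λ x y z → (x ⊕ y) ⊕ z ⊜ (x ⊕ z) ⊕ y) ↭-refl (range k R) (range (w + k) R)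
          (range (R + k) M) ⟩
    (range k R ++ range (R + k) M) ++ range (w + k) R
      ≡⟨ cong (_++ range (w + k) R) (range-++ k R M) ⟨
    range k w ++ range (w + k) R
      ≡⟨ range-++ k w R ⟨
    range k (w + R)
      ≡⟨ cong (λ n → range k (n + R)) (+-identityʳ w) ⟨
    range k (w + 0 + R) ∎
    where open PermutationReasoning
  grid (suc h) k R M refl = begin
    (range k R ++ rect (suc h) (map (w +_) (range k R))) ++
        (range (R + k) M ++ rect h (map (w +_) (range (R + k) M)))
      ≡⟨ cong₂ (λ xs ys → (range k R ++ rect (suc h) xs) ++ (range (R + k) M ++ rect h ys))
           (map-range w k R) (trans (map-range w (R + k) M) (cong (λ i → range i M) (swap w R k))) ⟩
    (range k R ++ rect (suc h) (range (w + k) R)) ++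
        (range (R + k) M ++ rect h (range (R + (w + k)) M))
      ↭⟨ permute 4 (λ x y z u → (x ⊕ y) ⊕ (z ⊕ u) ⊜ (x ⊕ z) ⊕ (y ⊕ u)) ↭-refl
           (range k R) (rect (suc h) (range (w + k) R)) (range (R + k) M)
               (rect h (range (R + (w + k)) M)) ⟩
    (range k R ++ range (R + k) M) ++
        (rect (suc h) (range (w + k) R) ++ rect h (range (R + (w + k)) M))
      ↭⟨ ++⁺ (↭-reflexive (sym (range-++ k R M))) (grid h (w + k) R M refl) ⟩
    range k w ++ range (w + k) (suc h * w + R)
      ≡⟨ range-++ k w (suc h * w + R) ⟨
    range k (w + (suc h * w + R))
      ≡⟨ cong (range k) (+-assoc w (suc h * w) R) ⟨
    range k (suc (suc h) * w + R) ∎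
    where
    open PermutationReasoning
    swap : ∀ w R k → w + (R + k) ≡ R + (w + k)
    swap = solve-∀

  at-Adj : ∀ s n {d x y} → Adj d x y → Adj d (at s n x) (at s n y)
  at-Adj low  n p = p
  at-Adj high n p = Adj-shift (n * w) p

  module Columns {D : Cost} (tee : D w 0 0) where

    column : ∀ n x → Route D x (n * w + x) (rect n (x ∷ [])) 0 0
    column zero    x = single x
    column (suc n) x = to (shift (n * w) w x) (link tee (up refl) (single x) (column n (w + x)))
      where
      shift : ∀ nw w x → nw + (w + x) ≡ w + nw + x
      shift = solve-∀

    columnFrom : ∀ s n x → Route D (at s n x) (at (opposite s) n x) (rect n (x ∷ [])) 0 0
    columnFrom low  n x = column n x
    columnFrom high n x = reverse (column n x)

    -- Each vertex of a walk in the bottom row is replaced by its whole column. All columns have n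
    -- edges, so a step of the walk can be taken along the bottom or along the top, wherever the
    -- last column ended.
    lift : ∀ {D₀ : Cost} → (∀ {d a b} → D₀ d a b → D d a b) → ∀ s n {x y vs a b} →
        Route D₀ x y vs a b →
           Route D (at s n x) (at (opposite^ (length vs) s) n y) (rect n vs) a b
    lift {D₀} inc s n {y = y} (route w p) =
      to (cong (λ l → at (opposite^ l s) n y) (↭-length p)) (recover (rect-↭ n p) (go s w))
      where
      go : ∀ s {x y a b} (w : Walk D₀ x y a b) →
           Route D (at s n x) (at (opposite^ (length (verts w)) s) n y) (rect n (verts w)) a b
      go s (stop x) = columnFrom s n x
      go s (step {x = x} e p w) =
        recover (↭-sym (rect-++ n (x ∷ []) (verts w)))
          (link (inc e) (at-Adj (opposite s) n p) (columnFrom s n x) (go (opposite s) w))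

    liftRange : ∀ {D₀ : Cost} → (∀ {d a b} → D₀ d a b → D d a b) → ∀ s n {x y k m a b} →
        Route D₀ x y (range k m) a b →
           Route D (at s n x) (at (opposite^ m s) n y) (rect n (range k m)) a b
    liftRange inc s n {y = y} {k} {m} r =
      to (cong (λ l → at (opposite^ l s) n y) (length-range k m)) (lift inc s n r)

module Stairs (w : ℕ) where
  open Grid w
  open Columns {Scaled w} tee

  -- Two columns bring the route back to the side it came from; hence the even counts m * 2 in
  -- `ascend` and `descend`.
  pair : ∀ s n x →
      Route (Scaled w) (at s n x) (at s n (suc x)) (rect n (x ∷ []) ++ rect n (suc x ∷ [])) 1 0
  pair low  n x =
      link one (at-Adj high n (up refl)) (columnFrom low n x) (columnFrom high n (suc x))
  pair high n x = link one (up refl) (columnFrom high n x) (columnFrom low n (suc x))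

  rect-pair : ∀ n x k vs →
      (rect n (x ∷ []) ++ rect n (suc x ∷ [])) ++ rect n (range (suc (suc x)) k) ++ vs
                          ↭ rect n (range x (suc (suc k))) ++ vs
  rect-pair n x k vs = ↭-trans (↭-sym (++-assoc _ (rect n (range (suc (suc x)) k)) vs))
    (++⁺ʳ vs (↭-sym (↭-trans (rect-++ n (x ∷ suc x ∷ []) (range (suc (suc x)) k))
      (++⁺ʳ (rect n (range (suc (suc x)) k)) (rect-++ n (x ∷ []) (suc x ∷ []))))))

  ascend : ∀ s n m {x y vs a b} → Route (Scaled w) (at s n (m * 2 + x)) y vs a b →
           Route (Scaled w) (at s n x) y (rect n (range x (m * 2)) ++ vs) (m * 2 + a) b
  ascend s n zero    {vs = vs} r = recover (↭-reflexive (cong (_++ vs) (sym (rect-[] n)))) r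
  ascend s n (suc m) {x} {vs = vs} r =
    recover (rect-pair n x (m * 2) vs)
      (link one (at-Adj s n (up refl)) (pair s n x)
        (ascend s n m (from (cong (at s n) (sym (shift (m * 2) x))) r)))
    where
    shift : ∀ k x → k + suc (suc x) ≡ suc (suc (k + x))
    shift = solve-∀

  descend : ∀ s n m {x y vs a b} → Route (Scaled w) (at s n x) y vs a b →
            Route (Scaled w) (at s n (m * 2 + x)) y (rect n (range (suc x) (m * 2)) ++ vs)
                (m * 2 + a) b
  descend s n zero    {vs = vs} r = recover (↭-reflexive (cong (_++ vs) (sym (rect-[] n)))) r
  descend s n (suc m) {x} {vs = vs} {a} r =
    from (cong (at s n) (shift (m * 2) x))
      (recover perm
          (recount (descend s n m
          (link one (at-Adj s n (down refl)) (reverse (pair s n (suc x))) r))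
        (shift (m * 2) a) refl))
    where
    shift : ∀ k x → k + suc (suc x) ≡ suc (suc (k + x))
    shift = solve-∀
    perm : rect n (range (suc (suc (suc x))) (m * 2)) ++
        ((rect n (suc x ∷ []) ++ rect n (suc (suc x) ∷ [])) ++ vs)
           ↭ rect n (range (suc x) (suc (suc (m * 2)))) ++ vs
    perm = ↭-trans
        (permute 3 (λ x y z → x ⊕ (y ⊕ z) ⊜ y ⊕ (x ⊕ z)) ↭-refl
        (rect n (range (suc (suc (suc x))) (m * 2)))
        (rect n (suc x ∷ []) ++ rect n (suc (suc x) ∷ [])) vs)
                   (rect-pair n (suc x) (m * 2) vs)

  snake : ∀ s n k x → Route (Scaled w) (at s n x) (at (opposite^ (suc k) s) n (k + x))
      (rect n (range x (suc k))) k 0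
  snake s n zero    x = columnFrom s n x
  snake s n (suc k) x =
    to (cong (at (opposite^ k (opposite (opposite s))) n) (+-suc k x))
      (recover (↭-sym (rect-++ n (x ∷ []) (range (suc x) (suc k))))
        (link one (at-Adj (opposite s) n (up refl)) (columnFrom s n x)
            (snake (opposite s) n k (suc x))))

  rect-range : ∀ n x k → rect n (range x (suc k)) ↭ rect n (x ∷ []) ++ rect n (range (suc x) k)
  rect-range n x k = rect-++ n (x ∷ []) (range (suc x) k)

  -- In the routes below the first m * 2 or suc (m * 2) columns have suc h edges
  -- each and the remaining ones h.

  staircase-even : ∀ h m k → w ≡ m * 2 + suc k →
         Route (Scaled w) 0 (at (opposite^ (suc k) low) h (k + (m * 2 + 0)))
             (range 0 (suc h * w + m * 2)) (m * 2 + k) 0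
  staircase-even h m k eq =
      recover (grid h 0 (m * 2) (suc k) eq) (ascend low (suc h) m (snake low h k (m * 2 + 0)))

  -- The last step, from column w − 1 to column 0, is possible along the top, where
  -- column 0 continues the row as column w.
  wrap : ∀ h m k x → w ≡ k * 2 + suc (m * 2 + x) →
         Route (Scaled w) x 0
           (rect (suc h) (range x (m * 2)) ++
               (rect h (range (m * 2 + x) (suc (k * 2))) ++ rect (suc h) (0 ∷ [])))
           (m * 2 + suc (k * 2)) 0
  wrap h m k x eq = recover perm (recount
    (ascend low (suc h) m (link one (at-Adj high h (up refl)) (column h r)
      (ascend high h k
          (from (trans (+-identityʳ (suc h * w)) (trans (+-comm w (h * w)) (cong (h * w +_) eq)))
          (reverse (column (suc h) 0))))))
    (cong (m * 2 +_) (cong suc (+-identityʳ (k * 2)))) refl)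
    where
    r = m * 2 + x
    perm : rect (suc h) (range x (m * 2)) ++
        (rect h (r ∷ []) ++ (rect h (range (suc r) (k * 2)) ++ rect (suc h) (0 ∷ [])))
           ↭ rect (suc h) (range x (m * 2)) ++
               (rect h (range r (suc (k * 2))) ++ rect (suc h) (0 ∷ []))
    perm = ++⁺ˡ (rect (suc h) (range x (m * 2)))
      (↭-trans (↭-sym (++-assoc (rect h (r ∷ [])) _ _)) (++⁺ʳ _ (↭-sym (rect-range h r (k * 2)))))

  gridFrom0 : ∀ h R {R′} M → R ≡ R′ → w ≡ R + M → rect (suc h) (range 0 R) ++ rect h (range R′ M) ↭
      range 0 (suc h * w + R)
  gridFrom0 h R M refl eq = ↭-trans
    (↭-reflexive
        (cong (λ j → rect (suc h) (range 0 R) ++ rect h (range j M)) (sym (+-identityʳ R))))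
    (grid h 0 R M eq)

  -- Column 0 is set aside and reached through `wrap`. The even number of tall columns that remain
  -- leads back to the bottom, where the short ones are entered. Reversal makes 0 the start.
  staircase-odd : ∀ h m k → w ≡ suc (m * 2) + suc (k * 2) →
        Route (Scaled w) 0 1 (range 0 (suc h * w + suc (m * 2))) (m * 2 + suc (k * 2)) 0
  staircase-odd h m k eq =
      reverse (recover perm (wrap h m k 1 (trans eq (reorder (m * 2) (k * 2)))))
    where
    reorder : ∀ m k → suc m + suc k ≡ k + suc (m + 1)
    reorder = solve-∀
    perm : rect (suc h) (range 1 (m * 2)) ++
        (rect h (range (m * 2 + 1) (suc (k * 2))) ++ rect (suc h) (0 ∷ []))
           ↭ range 0 (suc h * w + suc (m * 2))
    perm = ↭-trans
        (permute 3 (λ x y z → x ⊕ (y ⊕ z) ⊜ (z ⊕ x) ⊕ y) ↭-refl (rect (suc h) (range 1 (m * 2)))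
        (rect h (range (m * 2 + 1) (suc (k * 2)))) (rect (suc h) (0 ∷ [])))
      (↭-trans (++⁺ʳ _ (↭-sym (rect-range (suc h) 0 (m * 2))))
        (gridFrom0 h (suc (m * 2)) (suc (k * 2)) (+-comm 1 (m * 2)) eq))

  -- Without column 0 an odd number of tall columns remains, so column 1 is entered at its top.
  -- After reversal the route ends there, as `twoOnes-even` requires.
  wrapped-even : ∀ h m k → w ≡ suc m * 2 + suc (k * 2) →
          Route (Scaled w) 0 (suc h * w + 1) (range 0 (suc h * w + suc m * 2)) (suc m * 2 + k * 2) 0
  wrapped-even h m k eq = reverse (recover perm (recount
      (link one (up refl) (reverse (column (suc h) 1))
          (wrap h m k 2 (trans eq (reorder (m * 2) (k * 2)))))
      (count (m * 2) (k * 2)) refl))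
    where
    reorder : ∀ m k → suc (suc m) + suc k ≡ k + suc (m + 2)
    reorder = solve-∀
    count : ∀ m k → suc (m + suc k) ≡ suc (suc m) + k
    count = solve-∀
    perm : rect (suc h) (1 ∷ []) ++
        (rect (suc h) (range 2 (m * 2)) ++
        (rect h (range (m * 2 + 2) (suc (k * 2))) ++ rect (suc h) (0 ∷ [])))
           ↭ range 0 (suc h * w + suc m * 2)
    perm = ↭-trans
        (permute 4 (λ x y z u → x ⊕ (y ⊕ (z ⊕ u)) ⊜ (u ⊕ (x ⊕ y)) ⊕ z) ↭-refl
        (rect (suc h) (1 ∷ [])) (rect (suc h) (range 2 (m * 2)))
        (rect h (range (m * 2 + 2) (suc (k * 2)))) (rect (suc h) (0 ∷ [])))
      (↭-trans (++⁺ʳ _ (++⁺ˡ (rect (suc h) (0 ∷ [])) (↭-sym (rect-range (suc h) 1 (m * 2)))))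
      (↭-trans (++⁺ʳ _ (↭-sym (rect-range (suc h) 0 (suc (m * 2)))))
        (gridFrom0 h (suc m * 2) (suc (k * 2)) (+-comm 2 (m * 2)) eq)))

  -- Read backwards, the short columns are crossed in pairs along the top, up to the top of column
  -- 0, the only tall one.
  wrapped-single : ∀ h k → w ≡ suc (k * 2) →
      Route (Scaled w) 0 (h * w + 1) (range 0 (suc h * w + 1)) (k * 2) 0
  wrapped-single h k eq = reverse (recover perm (recount
      (ascend high h k {1}
          (from (trans (+-identityʳ (suc h * w))
          (trans (+-comm w (h * w)) (cong (h * w +_) (trans eq (+-comm 1 (k * 2))))))
          (reverse (column (suc h) 0))))
      (+-identityʳ (k * 2)) refl))
    where
    perm : rect h (range 1 (k * 2)) ++ rect (suc h) (0 ∷ []) ↭ range 0 (suc h * w + 1)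
    perm = ↭-trans (++-comm (rect h (range 1 (k * 2))) _) (grid h 0 1 (k * 2) eq)

  -- Column 2 is visited in two parts: its topmost vertex, and later the rest.
  wrapped-broken : ∀ h m k → w ≡ suc (suc m) * 2 + suc (k * 2) →
          Route (Scaled w) 0 (h * w + 2) (range 0 (suc h * w + suc (suc m) * 2)) w 0
  wrapped-broken h m k eq = reverse (recover perm (recount
      (link one (down refl) (reverse (column h 2))
      (link one (up (sym (+-suc (suc h * w) 1))) (column (suc h) 1)
      (link one (up (sym (+-suc (suc h * w) 2))) (single (suc h * w + 2))
      (link one (up refl) (reverse (column (suc h) 3))
        (wrap h m k 4 (trans eq (reorder (m * 2) (k * 2))))))))
      (trans (count (m * 2) (k * 2)) (sym eq)) refl))
    where
    reorder : ∀ m k → suc (suc (suc (suc m))) + suc k ≡ k + suc (m + 4)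
    reorder = solve-∀
    count : ∀ m k → suc (suc (suc (suc (m + suc k)))) ≡ suc (suc (suc (suc m))) + suc k
    count = solve-∀
    perm : rect h (2 ∷ []) ++
        (rect (suc h) (1 ∷ []) ++
        ((suc h * w + 2 ∷ []) ++
        (rect (suc h) (3 ∷ []) ++
        (rect (suc h) (range 4 (m * 2)) ++
        (rect h (range (m * 2 + 4) (suc (k * 2))) ++ rect (suc h) (0 ∷ []))))))
           ↭ range 0 (suc h * w + suc (suc m) * 2)
    perm = ↭-trans
        (permute 7
        (λ a b c d x y z → a ⊕ (b ⊕ (c ⊕ (d ⊕ (x ⊕ (y ⊕ z))))) ⊜ (z ⊕ (b ⊕ ((a ⊕ c) ⊕ (d ⊕ x)))) ⊕
        y) ↭-refl
             (rect h (2 ∷ [])) (rect (suc h) (1 ∷ [])) (suc h * w + 2 ∷ []) (rect (suc h) (3 ∷ []))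
                 (rect (suc h) (range 4 (m * 2))) (rect h (range (m * 2 + 4) (suc (k * 2))))
                 (rect (suc h) (0 ∷ [])))
      (↭-trans (++⁺ʳ _ (↭-sym
        (↭-trans (rect-range (suc h) 0 (suc (suc (suc (m * 2))))) (++⁺ˡ (rect (suc h) (0 ∷ []))
        (↭-trans (rect-range (suc h) 1 (suc (suc (m * 2)))) (++⁺ˡ (rect (suc h) (1 ∷ []))
        (↭-trans (rect-range (suc h) 2 (suc (m * 2)))
            (++⁺ (rect-top h 2) (rect-range (suc h) 3 (m * 2))))))))))
        (gridFrom0 h (suc (suc m) * 2) (suc (k * 2)) (+-comm 4 (m * 2)) eq))

  -- The columns are taken from w - 1 down to 0. An even number of them precedes column 0, so the
  -- route ends at the top of column 0, and the two parity classes can be joined there.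
  descending-odd : ∀ h m k → w ≡ suc (m * 2) + k * 2 →
         Route (Scaled w) (m * 2 + k * 2) (suc h * w) (range 0 (suc h * w + suc (m * 2)))
             (m * 2 + k * 2) 0
  descending-odd h m k eq =
      from (trans (cong (k * 2 +_) (+-identityʳ (m * 2))) (+-comm (k * 2) (m * 2)))
      (to (+-identityʳ (suc h * w)) (recover perm (recount
      (descend low h k (descend low (suc h) m (column (suc h) 0)))
          (trans (cong (k * 2 +_) (+-identityʳ (m * 2))) (+-comm (k * 2) (m * 2))) refl)))
    where
    perm : rect h (range (suc (m * 2 + 0)) (k * 2)) ++
        (rect (suc h) (range 1 (m * 2)) ++ rect (suc h) (0 ∷ []))
           ↭ range 0 (suc h * w + suc (m * 2))
    perm = ↭-trans
        (permute 3 (λ x y z → x ⊕ (y ⊕ z) ⊜ (z ⊕ y) ⊕ x) ↭-refl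
        (rect h (range (suc (m * 2 + 0)) (k * 2))) (rect (suc h) (range 1 (m * 2)))
        (rect (suc h) (0 ∷ [])))
      (↭-trans (++⁺ʳ _ (↭-sym (rect-range (suc h) 0 (m * 2))))
        (grid h 0 (suc (m * 2)) (k * 2) eq))

  -- The column suc (m * 2) comes last; e = suc h and e = h yield two routes that
  -- start at the same vertex and whose sizes differ by one.
  rotated : ∀ h m k e → w ≡ suc m * 2 + suc (k * 2) →
            Route (Scaled w) (suc m * 2) (e * w + suc (m * 2))
              (rect h (range (suc m * 2) (suc (k * 2))) ++
                  (rect (suc h) (range 0 (suc (m * 2))) ++ rect e (suc (m * 2) ∷ [])))
              (suc m * 2 + k * 2) 0
  rotated h m k e eq = recover perm (recount
      (link one (at-Adj high h (up refl)) (column h ρ)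
        (ascend high h k (from wrapEq (ascend high (suc h) m {0}
          (link one (up (cong suc (+-identityʳ (m * 2)))) (reverse (column (suc h) (m * 2 + 0)))
              (column e (suc (m * 2))))))))
      (count (m * 2) (k * 2)) refl)
    where
    ρ = suc m * 2
    wrapEq : suc h * w + 0 ≡ h * w + (k * 2 + suc ρ)
    wrapEq = trans (+-identityʳ (suc h * w))
        (trans (+-comm w (h * w)) (cong (h * w +_) (trans eq (reorder ρ (k * 2)))))
      where
      reorder : ∀ m k → m + suc k ≡ k + suc m
      reorder = solve-∀
    count : ∀ m k → suc (k + (m + 1)) ≡ suc (suc m) + k
    count = solve-∀
    perm : rect h (ρ ∷ []) ++
        (rect h (range (suc ρ) (k * 2)) ++
        (rect (suc h) (range 0 (m * 2)) ++
        (rect (suc h) (m * 2 + 0 ∷ []) ++ rect e (suc (m * 2) ∷ []))))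
           ↭ rect h (range ρ (suc (k * 2))) ++
               (rect (suc h) (range 0 (suc (m * 2))) ++ rect e (suc (m * 2) ∷ []))
    perm = ↭-trans
        (permute 5 (λ a b c d e → a ⊕ (b ⊕ (c ⊕ (d ⊕ e))) ⊜ (a ⊕ b) ⊕ ((c ⊕ d) ⊕ e)) ↭-refl
             (rect h (ρ ∷ [])) (rect h (range (suc ρ) (k * 2))) (rect (suc h) (range 0 (m * 2)))
                 (rect (suc h) (m * 2 + 0 ∷ [])) (rect e (suc (m * 2) ∷ [])))
      (++⁺ (↭-sym (rect-range h ρ (k * 2)))
        (++⁺ʳ _ (↭-sym
            (↭-trans (↭-reflexive
            (cong (rect (suc h))
            (trans (cong (range 0) (+-comm 1 (m * 2))) (range-++ 0 (m * 2) 1))))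
          (rect-++ (suc h) (range 0 (m * 2)) _)))))

-- Forks

record Path (t a b v : ℕ) : Set where
  constructor path
  field
    {start end} : ℕ
    path-route  : Route (Long t) start end (range 0 v) a b

Realizable : ℕ → ℕ → ℕ → ℕ → Set
Realizable t a b c = Path t a b (a + b + c + 1)

record Fork (t a b v : ℕ) : Set where
  constructor fork
  field
    {end₀ end₁ a₀ a₁ b₀ b₁} : ℕ
    {vs₀ vs₁}   : List ℕ
    from₀       : Route (Long t) 0 end₀ vs₀ a₀ b₀
    from₁       : Route (Long t) 1 end₁ vs₁ a₁ b₁
    fork-covers : vs₀ ++ vs₁ ↭ range 0 v
    fork-ones   : a₀ + a₁ ≡ a
    fork-twos   : b₀ + b₁ ≡ b

join : ∀ {t a b v} → Fork t a b v → Path t (suc a) b v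
join (fork {a₀ = a₀} {a₁} r₀ r₁ p refl refl) =
  path (recover p (recount (link (short one) (up refl) (reverse r₀) r₁) (+-suc a₀ a₁) refl))

map-suc-range : ∀ {vs} k n → vs ↭ range k n → map suc vs ↭ range (suc k) n
map-suc-range k n p = ↭-trans (map⁺ suc p) (↭-reflexive (map-range 1 k n))

-- After shifting by 1 the routes start at 1 and 2; the new vertex 0 is attached
-- to 2.
grow₁ : ∀ {t a b v} → Fork t a b v → Fork t a (suc b) (suc v)
grow₁ {v = v} (fork {a₀ = a₀} {a₁} {b₀} {b₁} {vs₀} {vs₁} r₀ r₁ p refl refl) =
  fork (link (short two) (up refl) (single 0) (translate 1 r₁)) (translate 1 r₀)
    (prep 0 (↭-trans (↭-reflexive (sym (map-++ suc vs₁ vs₀)))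
        (map-suc-range 0 v (↭-trans (++-comm vs₁ vs₀) p))))
    (+-comm a₁ a₀) (cong suc (+-comm b₁ b₀))

grow : ∀ k {t a b v} → Fork t a b v → Fork t a (k + b) (k + v)
grow zero    f = f
grow (suc k) f = grow₁ (grow k f)

-- Shifting by 1 makes room for a new vertex 0, which forms a route by itself.
isolate : ∀ {t y v a b} → Route (Long t) 0 y (range 0 v) a b → Fork t a b (suc v)
isolate {v = v} r = fork (single 0) (translate 1 r) (prep 0 (map-suc-range 0 v ↭-refl)) refl refl

prefix : ∀ {D : Cost} → D 1 1 0 → ∀ {y v a b} → Route D 0 y (range 0 v) a b →
    Route D 0 (suc y) (range 0 (suc v)) (suc a) b
prefix e {v = v} r =
    recover (prep 0 (map-suc-range 0 v ↭-refl)) (link e (up refl) (single 0) (translate 1 r))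

resize : ∀ {D x y n n′ a b} → Route D x y (range 0 n) a b → n ≡ n′ → Route D x y (range 0 n′) a b
resize r refl = r

realize : ∀ {t a b b′ c v} → Path t a b v → b ≡ b′ → v ≡ a + b′ + c + 1 → Realizable t a b′ c
realize (path r) p q = path (recount (resize r q) refl p)

-- Even and odd vertices covered separately

data Balanced (m : ℕ) : ℕ → Set where
  equal  : Balanced m m
  excess : ∀ {n} → m ≡ suc n → Balanced m n

map-affine-range : ∀ k m n → map (affine k) (range (suc m) n) ≡
    map (affine (suc (suc k))) (range m n)
map-affine-range k m zero    = refl
map-affine-range k m (suc n) = cong₂ _∷_ (shift k (m * 2)) (map-affine-range k (suc m) n)
  where
  shift : ∀ k m → k + suc (suc m) ≡ suc (suc (k + m))
  shift = solve-∀

double-+ : ∀ n → n + n ≡ n * 2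
double-+ = solve-∀

halves : ∀ {m n} → Balanced m n → map (affine 0) (range 0 m) ++ map (affine 1) (range 0 n) ↭
    range 0 (m + n)
halves {m} equal =
    ↭-trans (affine-interleave 0 0 m) (↭-reflexive (cong (range 0) (sym (double-+ m))))
halves {n = n} (excess refl) =
    prep 0 (↭-trans (++-comm (map (affine 0) (range 1 n)) (map (affine 1) (range 0 n)))
  (↭-trans (++⁺ˡ _ (↭-reflexive (map-affine-range 0 0 n)))
  (↭-trans (affine-interleave 1 0 n) (↭-reflexive (cong (range 1) (sym (double-+ n)))))))

-- Inside a class all lengths are doubled, so the edge between the two classes is the only one of
-- length 1.
joinHalves : ∀ {s m n x y y′ z a a′} → Route (Scaled s) x y (range 0 m) a 0 →
    Route (Scaled s) y′ z (range 0 n) a′ 0 →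
             Balanced m n → Adj 1 (affine 0 y) (affine 1 y′) → Path (s * 2) 1 (a + a′) (m + n)
joinHalves r r′ bal p = path (recover (halves bal) (link (short one) p (double 0 r) (double 1 r′)))

forkHalves : ∀ {s m n y z a a′} → Route (Scaled s) 0 y (range 0 m) a 0 →
    Route (Scaled s) 0 z (range 0 n) a′ 0 →
             Balanced m n → Fork (s * 2) 0 (a + a′) (m + n)
forkHalves r r′ bal = fork (double 0 r) (double 1 r′) (halves bal) refl refl

-- Both classes use the same route, so its ends become consecutive integers; running the odd copy
-- backwards leads to 1.
closedDouble : ∀ {s m y a} → Route (Scaled s) 0 y (range 0 m) a 0 →
    Route (Long (s * 2)) 0 1 (range 0 (m + m)) 1 (a + a)
closedDouble {m = m} r =
    recover (halves {m} equal) (link (short one) (up refl) (double 0 r) (reverse (double 1 r)))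

-- x edges of length 1 and y of length s.
record Standard (s x y : ℕ) : Set where
  constructor standard
  field
    {end} : ℕ
    standard-route : Route (Scaled s) 0 end (range 0 (suc (x + y))) x 0

open Standard using (standard-route)

standard-prefix : ∀ {s x y} → Standard s x y → Standard s (suc x) y
standard-prefix (standard r) = standard (prefix one r)

standard-even : ∀ h m k {s y} → s ≡ m * 2 + suc k → y ≡ m * 2 + h * s → Standard s (m * 2 + k) y
standard-even h m k refl refl =
    standard (resize (Stairs.staircase-even _ h m k refl) (size (m * 2) k h))
  where
  size : ∀ m k h → suc h * (m + suc k) + m ≡ suc (m + k + (m + h * (m + suc k)))
  size = solve-∀

standard-odd : ∀ h m k {s y} → s ≡ suc (m * 2) + suc (k * 2) → y ≡ suc (m * 2) + h * s →
    Standard s (m * 2 + suc (k * 2)) y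
standard-odd h m k refl refl =
    standard (resize (Stairs.staircase-odd _ h m k refl) (size (m * 2) (k * 2) h))
  where
  size : ∀ m k h → suc h * (suc m + suc k) + suc m ≡ suc (m + suc k + (suc m + h * (suc m + suc k)))
  size = solve-∀

-- Compared with a route along full columns, one edge of length s is traded for one of length 1:
-- either a vertex is put in front of a smaller grid or column 2 is broken.
standard-extra : ∀ h m k {s y} → s ≡ suc m * 2 + suc (k * 2) → y ≡ suc (m * 2) + h * s →
    Standard s s y
standard-extra h zero    k refl refl =
    standard (resize (prefix one (Stairs.wrapped-single _ h (suc k) refl)) (size (k * 2) h))
  where
  size : ∀ k h → suc (suc h * suc (suc (suc k)) + 1) ≡
      suc (suc (suc (suc k)) + (1 + h * suc (suc (suc k))))
  size = solve-∀
standard-extra h (suc m) k refl refl =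
    standard (resize (Stairs.wrapped-broken _ h m k refl) (size (m * 2) (k * 2) h))
  where
  size : ∀ m k h → suc h * (4 + m + suc k) + (4 + m) ≡
      suc (4 + m + suc k + (3 + m + h * (4 + m + suc k)))
  size = solve-∀

realizeHalves : ∀ {s x y x′ y′ b c} → Standard s x y → Standard s x′ y′ →
    Balanced (suc (x + y)) (suc (x′ + y′)) →
                ∀ k → k + (x + x′) ≡ b → y + y′ ≡ c → Realizable (s * 2) 1 b c
realizeHalves {x = x} {y} {x′} {y′} (standard r) (standard r′) bal k p q =
  realize (join (grow k (forkHalves r r′ bal))) p
    (trans (size k x y x′ y′) (cong₂ (λ b c → 1 + b + c + 1) p q))
  where
  size : ∀ k x y x′ y′ → k + (suc (x + y) + suc (x′ + y′)) ≡ 1 + (k + (x + x′)) + (y + y′) + 1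
  size = solve-∀

balanced : ∀ {m n} → m ≡ n → Balanced m n
balanced refl = equal

-- a = 1

data Parity : ℕ → Set where
  twice     : ∀ m → Parity (m * 2)
  suc-twice : ∀ m → Parity (suc (m * 2))

parity : ∀ n → Parity n
parity zero = twice 0
parity (suc n) with parity n
... | twice m     = suc-twice m
... | suc-twice m = twice (suc m)

-- For a = 1 the least b is t - 2 = 2 (R + M), and k is the surplus. In general each class gets y
-- edges of length s, hence R tall columns. If R and M are both odd, the classes are joined at their
-- tops when k = 0; otherwise one edge of length s moves from the odd class to the even one.
singleOne-even : ∀ h {R M} → Parity R → Parity M → let s = R + suc M; y = R + h * s in
           ∀ k → Realizable (s * 2) 1 (k + ((R + M) + (R + M))) (y + y)
singleOne-even h {M = M} (twice m) _ k = realizeHalves S S equal k refl refl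
  where S = standard-even h m M refl refl
singleOne-even h (suc-twice m) (twice k′) k =
    realizeHalves S S equal k (cong (λ x → k + (x + x)) (+-suc (m * 2) (k′ * 2))) refl
  where S = standard-odd h m k′ refl refl
singleOne-even h (suc-twice m) (suc-twice k′) zero =
  realize (joinHalves r (reverse r) equal (up refl)) (twos (m * 2) (k′ * 2))
      (size (m * 2) (k′ * 2) h)
  where
  s = suc (m * 2) + suc k′ * 2
  r : Route (Scaled s) (m * 2 + suc k′ * 2) (suc h * s) (range 0 (suc h * s + suc (m * 2)))
      (m * 2 + suc k′ * 2) 0
  r = Stairs.descending-odd s h m (suc k′) refl
  twos : ∀ m k → (m + suc (suc k)) + (m + suc (suc k)) ≡ (suc m + suc k) + (suc m + suc k)
  twos = solve-∀
  size : ∀ m k h → let s = suc m + suc (suc k) in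
         (suc h * s + suc m) + (suc h * s + suc m) ≡
             1 + ((suc m + suc k) + (suc m + suc k)) + ((suc m + h * s) + (suc m + h * s)) + 1
  size = solve-∀
singleOne-even h (suc-twice m) (suc-twice k′) (suc k) =
  realizeHalves (standard-even h (suc m) (k′ * 2) (cong suc (+-suc (m * 2) _)) refl)
                (standard-prefix
                    (standard-even h m (suc (suc (k′ * 2))) (sym (+-suc (m * 2) _)) refl))
                (excess (excessEq (m * 2) (k′ * 2) z)) k (twos k (m * 2) (k′ * 2)) (tees (m * 2) z)
  where
  z = h * (suc (m * 2) + suc (suc (k′ * 2)))
  excessEq : ∀ m k z → suc ((suc (suc m) + k) + (suc (suc m) + z)) ≡
      suc (suc (suc (m + suc (suc k)) + (m + z)))
  excessEq = solve-∀
  twos : ∀ j m k → j + ((suc (suc m) + k) + suc (m + suc (suc k))) ≡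
      suc (j + ((suc m + suc k) + (suc m + suc k)))
  twos = solve-∀
  tees : ∀ m z → (suc (suc m) + z) + (m + z) ≡ (suc m + z) + (suc m + z)
  tees = solve-∀

-- The even class gets y + 1 edges of length s and the odd class y. The parities of R and M and the
-- surplus k decide which routes are joined.
singleOne-odd : ∀ h {R M} → Parity R → Parity M → let s = R + suc M; y = R + h * s in
          ∀ k → Realizable (s * 2) 1 (k + ((R + M) + (R + M))) (suc (y + y))
singleOne-odd h (twice m) (suc-twice k′) k =
  realizeHalves (standard-odd h m k′ (+-suc (m * 2) _) refl)
      (standard-even h m (suc (k′ * 2)) refl refl)
    (excess (cong suc (+-suc _ _))) k refl refl
singleOne-odd h (twice m) (twice zero) k =
  -- Since M = 0, y + 1 is (h + 1) * s, and all columns of the even class have the same height.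
  realizeHalves
      (standard-even (suc h) 0 (m * 2 + 0) (+-suc (m * 2) 0)
      (cong (_+ h * (m * 2 + 1)) (+-comm 1 (m * 2))))
    (standard-even h m 0 refl refl) (excess (cong suc (+-suc _ _))) k refl refl
singleOne-odd h (twice m) (twice (suc k′)) 0 =
  -- The even class ends at the top of column 0, the odd class at the top of column s - 1 one row
  -- lower. After doubling these are consecutive integers.
  realize (joinHalves (Stairs.descending-odd s h m (suc k′) (+-suc (m * 2) _)) (reverse even)
    (excess (+-suc _ _)) (down (near (h * s) (m * 2) (k′ * 2)))) refl (size (m * 2) (k′ * 2) h)
  where
  s = m * 2 + suc (suc k′ * 2)
  even : Route (Scaled s) 0 (h * s + (suc k′ * 2 + (m * 2 + 0))) (range 0 (suc h * s + m * 2))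
      (m * 2 + suc k′ * 2) 0
  even = to (cong (λ d → Grid.at s d h (suc k′ * 2 + (m * 2 + 0))) (opposite^-even k′ high))
      (Stairs.staircase-even s h m (suc k′ * 2) refl)
  near : ∀ z m k → 1 + (1 + (z + (suc (suc k) + (m + 0))) * 2) ≡ (m + suc (suc (suc k)) + z) * 2
  near = solve-∀
  size : ∀ m k h → let s = m + suc (suc (suc k)) in
         (suc h * s + suc m) + (suc h * s + m) ≡
             1 + ((m + suc (suc k)) + (m + suc (suc k))) + suc ((m + h * s) + (m + h * s)) + 1
  size = solve-∀
singleOne-odd h (twice m) (twice (suc k′)) 1 =
  -- The surplus edge puts a vertex in front of the odd class, whose end moves to the other side of
  -- that of the even class.
  realize (joinHalves (Stairs.descending-odd s h m (suc k′) (+-suc (m * 2) _)) (reverse even)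
    equal′ (up (near (h * s) (m * 2) (k′ * 2)))) (+-suc _ _) (size (m * 2) (k′ * 2) h)
  where
  s = m * 2 + suc (suc k′ * 2)
  even : Route (Scaled s) 0 (suc (h * s + (suc k′ * 2 + (m * 2 + 0))))
      (range 0 (suc (suc h * s + m * 2))) (suc (m * 2 + suc k′ * 2)) 0
  even = prefix one
      (to (cong (λ d → Grid.at s d h (suc k′ * 2 + (m * 2 + 0))) (opposite^-even k′ high))
      (Stairs.staircase-even s h m (suc k′ * 2) refl))
  equal′ : Balanced (suc h * s + suc (m * 2)) (suc (suc h * s + m * 2))
  equal′ = subst (Balanced _) (+-suc _ _) equal
  near : ∀ z m k → 1 + (m + suc (suc (suc k)) + z) * 2 ≡ 1 + (suc (z + (suc (suc k) + (m + 0)))) * 2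
  near = solve-∀
  size : ∀ m k h → let s = m + suc (suc (suc k)) in
         (suc h * s + suc m) + suc (suc h * s + m) ≡
             1 + suc ((m + suc (suc k)) + (m + suc (suc k))) + suc ((m + h * s) + (m + h * s)) + 1
  size = solve-∀
singleOne-odd h (twice m) (twice (suc k′)) (suc (suc k)) =
  -- Each class takes one edge more that doubles to length 2, which uses two of the surplus.
  realizeHalves (standard-extra h m k′ (splitEq (m * 2) (k′ * 2)) refl)
      (standard-prefix (standard-even h m (suc k′ * 2) refl refl))
    (excess (sizes (m * 2) (k′ * 2) z)) k (twos k (m * 2) (k′ * 2)) refl
  where
  z = h * (m * 2 + suc (suc k′ * 2))
  splitEq : ∀ m k → m + suc (suc (suc k)) ≡ suc (suc m) + suc k
  splitEq = solve-∀
  sizes : ∀ m k z → suc ((m + suc (suc (suc k))) + (suc m + z)) ≡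
      suc (suc (suc (m + suc (suc k)) + (m + z)))
  sizes = solve-∀
  twos : ∀ j m k → j + ((m + suc (suc (suc k))) + suc (m + suc (suc k))) ≡
      suc (suc (j + ((m + suc (suc k)) + (m + suc (suc k)))))
  twos = solve-∀
singleOne-odd h (suc-twice m) (twice zero) k =
  realizeHalves
      (standard-even (suc h) 0 (suc (m * 2 + 0)) (+-suc (suc (m * 2)) 0)
      (cong (λ i → suc i + h * (suc (m * 2) + 1)) (+-comm 1 (m * 2))))
    (standard-odd h m 0 refl refl) (excess (sizes (m * 2) (h * (suc (m * 2) + 1)))) k
        (twos k (m * 2)) refl
  where
  sizes : ∀ m z → suc (suc (m + 0) + suc (suc m + z)) ≡ suc (suc ((m + 1) + (suc m + z)))
  sizes = solve-∀
  twos : ∀ k m → k + (suc (m + 0) + (m + 1)) ≡ k + ((suc m + 0) + (suc m + 0))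
  twos = solve-∀
singleOne-odd h (suc-twice m) (twice (suc k′)) k =
  realizeHalves (standard-even h (suc m) (suc (k′ * 2)) (splitEq (m * 2) (k′ * 2)) refl)
      (standard-odd h m (suc k′) refl refl)
    (excess (sizes (m * 2) (k′ * 2) (h * (suc (m * 2) + suc (suc k′ * 2))))) k
        (twos k (m * 2) (k′ * 2)) refl
  where
  splitEq : ∀ m k → suc m + suc (suc (suc k)) ≡ suc (suc m) + suc (suc k)
  splitEq = solve-∀
  sizes : ∀ m k z → suc ((suc (suc m) + suc k) + (suc (suc m) + z)) ≡
      suc (suc ((m + suc (suc (suc k))) + (suc m + z)))
  sizes = solve-∀
  twos : ∀ j m k → j + ((suc (suc m) + suc k) + (m + suc (suc (suc k)))) ≡
      j + ((suc m + suc (suc k)) + (suc m + suc (suc k)))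
  twos = solve-∀
singleOne-odd h (suc-twice m) (suc-twice k′) zero =
  -- Both routes start at column 2 m + 2, so after doubling they start at consecutive integers and
  -- are joined there.
  realize (joinHalves (reverse big) small
      (excess {m = suc h * s + suc m * 2} {n = suc h * s + suc (m * 2)} (+-suc (suc h * s) _))
      (up refl))
    (twos (m * 2) (k′ * 2)) (size (m * 2) (k′ * 2) h)
  where
  s = suc (m * 2) + suc (suc (k′ * 2))
  splitEq : ∀ m k → suc m + suc (suc k) ≡ suc (suc m) + suc k
  splitEq = solve-∀
  open Grid s
  big : Route (Scaled s) (suc m * 2) (suc h * s + suc (m * 2)) (range 0 (suc h * s + suc m * 2))
      (suc m * 2 + k′ * 2) 0
  big = recover
    (↭-trans (++-comm (rect h (range (suc m * 2) (suc (k′ * 2)))) _)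
      (↭-trans (++⁺ʳ _ (↭-trans (↭-sym (rect-++ (suc h) (range 0 (suc (m * 2))) _))
          (↭-reflexive (cong (rect (suc h)) (range-snoc₀ (suc (m * 2)))))))
        (Stairs.gridFrom0 s h (suc m * 2) (suc (k′ * 2)) refl (splitEq (m * 2) (k′ * 2)))))
    (Stairs.rotated s h m k′ (suc h) (splitEq (m * 2) (k′ * 2)))
  small : Route (Scaled s) (suc m * 2) (h * s + suc (m * 2)) (range 0 (suc h * s + suc (m * 2)))
      (suc m * 2 + k′ * 2) 0
  small = recover
    (↭-trans (permute 3 (λ x y z → x ⊕ (y ⊕ z) ⊜ y ⊕ (z ⊕ x)) ↭-refl
        (rect h (range (suc m * 2) (suc (k′ * 2)))) (rect (suc h) (range 0 (suc (m * 2))))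
        (rect h (suc (m * 2) ∷ [])))
      (↭-trans (++⁺ˡ _ (↭-sym (Stairs.rect-range s h (suc (m * 2)) (suc (k′ * 2)))))
        (Stairs.gridFrom0 s h (suc (m * 2)) (suc (suc (k′ * 2))) refl refl)))
    (Stairs.rotated s h m k′ h (splitEq (m * 2) (k′ * 2)))
  twos : ∀ m k → (suc (suc m) + k) + (suc (suc m) + k) ≡ (suc m + suc k) + (suc m + suc k)
  twos = solve-∀
  size : ∀ m k h → let s = suc m + suc (suc k) in
         (suc h * s + suc (suc m)) + (suc h * s + suc m) ≡
             1 + ((suc m + suc k) + (suc m + suc k)) + suc ((suc m + h * s) + (suc m + h * s)) + 1
  size = solve-∀
singleOne-odd h (suc-twice m) (suc-twice k′) (suc k) =
  realizeHalves (standard-even h (suc m) (k′ * 2) (splitEq (m * 2) (k′ * 2)) refl)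
      (standard-extra h m k′ (splitEq (m * 2) (k′ * 2)) refl)
    (balanced (sizes (m * 2) (k′ * 2) (h * (suc (m * 2) + suc (suc (k′ * 2)))))) k
        (twos k (m * 2) (k′ * 2)) refl
  where
  splitEq : ∀ m k → suc m + suc (suc k) ≡ suc (suc m) + suc k
  splitEq = solve-∀
  sizes : ∀ m k z → suc ((suc (suc m) + k) + (suc (suc m) + z)) ≡
      suc ((suc m + suc (suc k)) + (suc m + z))
  sizes = solve-∀
  twos : ∀ j m k → j + ((suc (suc m) + k) + (suc m + suc (suc k))) ≡
      suc (j + ((suc m + suc k) + (suc m + suc k)))
  twos = solve-∀

-- a = 2

realizeFork : ∀ {t a b b′ c v} → ∀ k → Fork t a b v → k + b ≡ b′ → k + v ≡ suc a + b′ + c + 1 →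
    Realizable t (suc a) b′ c
realizeFork k f p q = realize (join (grow k f)) p q

-- One edge of length 1 lies between the two classes, the other comes from joining the fork.
twoOnes-even : ∀ h {R M} → Parity R → Parity M → let s = R + suc M; y = R + h * s in
           ∀ k → Realizable (s * 2) 2 (k + ((R + M) + (R + M))) (y + y)
twoOnes-even h {M = M} (twice m) _ k =
  realizeFork k (isolate (closedDouble (standard-route (standard-even h m M refl refl)))) refl
      (size (m * 2) M k (h * (m * 2 + suc M)))
  where
  size : ∀ m M k z → k + suc (suc (m + M + (m + z)) + suc (m + M + (m + z))) ≡
      2 + (k + ((m + M) + (m + M))) + ((m + z) + (m + z)) + 1
  size = solve-∀
twoOnes-even h (suc-twice m) (twice k′) k =
  realizeFork k (isolate (closedDouble (standard-route (standard-odd h m k′ refl refl))))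
      (twos (m * 2) (k′ * 2) k) (size (m * 2) (k′ * 2) k (h * (suc (m * 2) + suc (k′ * 2))))
  where
  twos : ∀ m M k → k + ((m + suc M) + (m + suc M)) ≡ k + ((suc m + M) + (suc m + M))
  twos = solve-∀
  size : ∀ m M k z → k + suc (suc (m + suc M + (suc m + z)) + suc (m + suc M + (suc m + z))) ≡
      2 + (k + ((suc m + M) + (suc m + M))) + ((suc m + z) + (suc m + z)) + 1
  size = solve-∀
twoOnes-even h (suc-twice m) (suc-twice k′) k =
  -- Vertex 1 is a route by itself. The remaining odd vertices start at 3, and their far end is next
  -- to that of the even ones.
  realizeFork k
      (fork (link (short one) (down (near (h * s) (m * 2) (k′ * 2))) (double 0 evens)
      (reverse (double 3 odds))) (single 1)
    perm refl (+-identityʳ _)) (twos (m * 2) (k′ * 2) k) (size (m * 2) (k′ * 2) k (h * s))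
  where
  s = suc (m * 2) + suc (suc (k′ * 2))
  N = suc h * s + m * 2
  evens : Route (Scaled s) 0 (suc h * s + 1) (range 0 (suc (suc N))) (suc m * 2 + k′ * 2) 0
  evens = resize (Stairs.wrapped-even s h m k′ (splitEq (m * 2) (k′ * 2)))
      (shift (suc h * s) (m * 2))
    where
    splitEq : ∀ m k → suc m + suc (suc k) ≡ suc (suc m) + suc k
    splitEq = solve-∀
    shift : ∀ z m → z + suc (suc m) ≡ suc (suc (z + m))
    shift = solve-∀
  odds : Route (Scaled s) 0 (h * s + (suc (suc (k′ * 2)) + (m * 2 + 0))) (range 0 N)
      (m * 2 + suc (suc (k′ * 2))) 0
  odds = to (cong (λ d → Grid.at s d h (suc (suc (k′ * 2)) + (m * 2 + 0))) (opposite^-even k′ high))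
    (Stairs.staircase-even s h m (suc (suc (k′ * 2))) (sym (+-suc (m * 2) _)))
  perm : (map (affine 0) (range 0 (suc (suc N))) ++ map (affine 3) (range 0 N)) ++ (1 ∷ []) ↭
      range 0 (suc (suc N) + suc N)
  perm = ↭-trans
      (permute 3 (λ x y z → (x ⊕ y) ⊕ z ⊜ x ⊕ (z ⊕ y)) ↭-refl
      (map (affine 0) (range 0 (suc (suc N)))) (map (affine 3) (range 0 N)) (1 ∷ []))
    (↭-trans (++⁺ˡ (map (affine 0) (range 0 (suc (suc N))))
        (prep 1 (↭-reflexive (sym (map-affine-range 1 0 N)))))
      (halves {suc (suc N)} {suc N} (excess refl)))
  near : ∀ z m k → 1 + (3 + (z + (suc (suc k) + (m + 0))) * 2) ≡ (suc m + suc (suc k) + z + 1) * 2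
  near = solve-∀
  twos : ∀ m j k → k + ((suc (suc m) + j) + (m + suc (suc j))) ≡
      k + ((suc m + suc j) + (suc m + suc j))
  twos = solve-∀
  size : ∀ m j k z → let N = suc m + suc (suc j) + z + m in
         k + (suc (suc N) + suc N) ≡
             2 + (k + ((suc m + suc j) + (suc m + suc j))) + ((suc m + z) + (suc m + z)) + 1
  size = solve-∀

-- p edges of length 1 and q of length 2 cover an interval starting from an end
-- of it: using edges of length 2 forces a turn, which costs an edge of length 1.
data Valid : ℕ → ℕ → Set where
  none : Valid 0 0
  some : ∀ p q → Valid (suc p) q

-- The route runs out on one parity and back on the other: x, x + 2, ..., x + 3, x + 1.
turn : ∀ q x → Route Short x (suc x) (range x (suc (suc q))) 1 q
turn zero    x = link one (up refl) (single x) (single (suc x))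
turn (suc q) x = link two (up refl) (single x) (reverse (turn q (suc x)))

zigzag : ∀ {p q} → Valid p q → ∀ x → ∃[ y ] Route Short x y (range x (suc (p + q))) p q
zigzag none             x = x , single x
zigzag (some zero q)    x = suc x , turn q x
zigzag (some (suc p) q) x =
  let y , r = zigzag (some p q) (suc x) in y , link one (up refl) (single x) r

turn↓ : ∀ q x → Route Short (suc (q + x)) (q + x) (range x (suc (suc q))) 1 q
turn↓ zero    x = recover (range-∷ʳ x 1) (link one (down refl) (single (suc x)) (single x))
turn↓ (suc q) x =
    recover (range-∷ʳ x (suc (suc q))) (link two (down refl) (single _) (reverse (turn↓ q x)))

zigzag↓ : ∀ {p q} → Valid p q → ∀ x → ∃[ y ] Route Short (p + q + x) y (range x (suc (p + q))) p q
zigzag↓ none             x = x , single x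
zigzag↓ (some zero q)    x = q + x , turn↓ q x
zigzag↓ (some (suc p) q) x =
  let y , r = zigzag↓ (some p q) x in y , recover (range-∷ʳ x (suc (suc (p + q))))
      (link one (down refl) (single _) r)

-- Zigzags through blocks of tall and short columns

module Blocks (t : ℕ) where
  open Grid t
  open Columns {Long t} tee

  -- Column 0 without the vertex 0 is column t of the grid based at 1.
  shortBlock : ∀ h {p q} R → Valid p q → t ≡ R + suc (p + q) →
               ∃[ y ] Route (Long t) 0 y (0 ∷ rect h (range (R + 1) (suc (p + q)))) p q
  shortBlock h {p} {q} R v eq =
    let y , r = zigzag↓ v (R + 1) in
    _ , link tee (up (trans (+-identityʳ t) (trans eq (reorder R (p + q))))) (single 0)
        (liftRange short low h r)
    where
    reorder : ∀ R m → R + suc m ≡ m + (R + 1)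
    reorder = solve-∀

  gridFrom1 : ∀ h R M → t ≡ R + M → rect (suc h) (range 1 R) ++ 0 ∷ rect h (range (R + 1) M) ↭
      range 0 (suc (suc h * t + R))
  gridFrom1 h R M eq = ↭-trans
    (permute 3 (λ x y z → x ⊕ (y ⊕ z) ⊜ y ⊕ (x ⊕ z)) ↭-refl (rect (suc h) (range 1 R)) (0 ∷ [])
        (rect h (range (R + 1) M)))
    (prep 0 (grid h 1 R M eq))

  -- No edge passes between tall and short columns: the route from 0 takes the short ones, that from
  -- 1 the tall ones. The counts sum to t - 2, so joining attains a + b = t - 1.
  blockFork : ∀ h {p q p′ q′} → Valid p q → Valid p′ q′ → t ≡ suc (p + q) + suc (p′ + q′) →
              Fork t (p′ + p) (q′ + q) (suc (suc h * t + suc (p + q)))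
  blockFork h {p} {q} {p′} {q′} v v′ eq =
    let y , r = shortBlock h (suc (p + q)) v′ eq
        z , r′ = zigzag v 1 in
    fork r (liftRange short low (suc h) r′)
      (↭-trans (++-comm _ (rect (suc h) (range 1 (suc (p + q)))))
          (gridFrom1 h (suc (p + q)) (suc (p′ + q′)) eq)) refl refl

  -- Without tall columns, column t continues the vertex 0 and the other columns form one block.
  blockFork₀ : ∀ h {p q} → Valid p q → t ≡ suc (suc (p + q)) → Fork t p q (suc (suc h * t))
  blockFork₀ h {p} {q} v eq =
    let z , r′ = zigzag v 1 in
    fork (link tee (up (+-identityʳ t)) (single 0) (column h t)) (liftRange short low h r′)
      (↭-trans (prep 0 perm)
          (↭-reflexive (cong (λ n → range 0 (suc n)) (+-identityʳ (suc h * t))))) refl refl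
    where
    n = suc (p + q)
    perm : rect h (t ∷ []) ++ rect h (range 1 n) ↭ range 1 (suc h * t + 0)
    perm = ↭-trans (↭-sym (rect-++ h (t ∷ []) (range 1 n)))
      (↭-trans (rect-↭ h
          (subst (λ u → u ∷ range 1 n ↭ range 1 t) (sym (trans eq (+-comm 1 n)))
          (subst (λ u → n + 1 ∷ range 1 n ↭ range 1 u) (sym eq) (range-∷ʳ 1 n))))
        (↭-trans (↭-reflexive (cong (_++ rect h (range 1 t)) (sym (rect-[] (suc h)))))
            (grid h 1 0 t refl)))

  -- The turns of the two blocks already use both edges of length 1. As the turn of the tall block
  -- runs between 1 and 2, its end 2 is joined to 0 by an edge of length 2.
  tightPath : ∀ h q q′ → t ≡ suc (suc q) + suc (suc q′) →
      Path t 2 (q′ + suc q) (suc (suc h * t + suc (suc q)))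
  tightPath h q q′ eq =
    let y , r = shortBlock h (suc (suc q)) (some 0 q′) eq in
    path (recover
        (↭-trans (++-comm _ (rect (suc h) (range 1 (suc (suc q)))))
        (gridFrom1 h (suc (suc q)) (suc (suc q′)) eq))
      (link (short two) (up refl) (reverse r) (liftRange short low (suc h) (reverse (turn q 1)))))

  ladder : ∀ x k n → Route Short (affine x k) (affine x (n + k)) (map (affine x) (range k (suc n)))
      0 n
  ladder x k zero    = single _
  ladder x k (suc n) = to (cong (affine x) (+-suc n k))
    (link two (up (shift x (k * 2))) (single _) (ladder x (suc k) n))
    where
    shift : ∀ x k → 2 + (x + k) ≡ x + suc (suc k)
    shift = solve-∀

  liftLadder : ∀ h x n → Route (Long t) x (at (opposite^ (suc n) low) h (affine x n))
      (rect h (map (affine x) (range 0 (suc n)))) 0 n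
  liftLadder h x n = from (+-identityʳ x)
    (to (cong₂ (λ l e → at (opposite^ l low) h (affine x e))
        (trans (length-map (affine x) (range 0 (suc n))) (length-range 0 (suc n))) (+-identityʳ n))
      (lift short low h (ladder x 0 n)))

  ladders : ∀ h {m n} R M → Balanced m n → R ≡ m + n → t ≡ R + M →
            rect (suc h) (map (affine 0) (range 0 m)) ++
                (rect (suc h) (map (affine 1) (range 0 n)) ++ rect h (range R M))
            ↭ range 0 (suc h * t + R)
  ladders h {m} {n} _ M bal refl eq =
      ↭-trans (↭-sym (++-assoc (rect (suc h) (map (affine 0) (range 0 m))) _ _))
    (↭-trans (++⁺ʳ _
        (↭-trans (↭-sym (rect-++ (suc h) (map (affine 0) (range 0 m)) _))
        (rect-↭ (suc h) (halves bal))))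
      (Stairs.gridFrom0 t h (m + n) M refl eq))

  -- Even and odd columns are climbed separately; a class with an even number of
  -- tall columns is left at the bottom, from where the short columns are reached.
  -- If there is only one short column, as in ladderFork₅′, no edge of length 1 is
  -- used there; instead one leads to an additional vertex above the grid.
  ladderFork₃ : ∀ h j q → let R = suc j * 2 + suc (j * 2) in t ≡ R + suc q →
             Fork t 1 (suc (j * 2) + q + j * 2) (suc h * t + R)
  ladderFork₃ h j q eq = fork (proj₂ (tail q)) (liftLadder (suc h) 1 (j * 2))
      (↭-trans (permute 3 (λ x y z → (x ⊕ z) ⊕ y ⊜ x ⊕ (y ⊕ z)) ↭-refl
          (rect (suc h) (map (affine 0) (range 0 (suc j * 2))))
              (rect (suc h) (map (affine 1) (range 0 (suc (j * 2))))) (rect h (range R (suc q))))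
        (ladders h {suc j * 2} {suc (j * 2)} R (suc q) (excess refl) refl eq))
      refl refl
    where
    R = suc j * 2 + suc (j * 2)
    evens : Route (Long t) 0 (affine 0 (suc (j * 2)))
        (rect (suc h) (map (affine 0) (range 0 (suc j * 2)))) 0 (suc (j * 2))
    evens = to (cong (λ d → at d (suc h) (affine 0 (suc (j * 2)))) (opposite^-even j low))
        (liftLadder (suc h) 0 (suc (j * 2)))
    next : ∀ j → 1 + suc j * 2 ≡ suc (suc (j + suc j))
    next = solve-∀
    tail : ∀ q →
        ∃[ y ] Route (Long t) 0 y
        (rect (suc h) (map (affine 0) (range 0 (suc j * 2))) ++ rect h (range R (suc q))) 1
        (suc (j * 2) + q)
    tail zero    = _ , link (short one) (up (next (j * 2))) evens (liftRange short low h (single R))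
    tail (suc q) =
        _ , link (short two) (up (cong suc (next (j * 2)))) evens
        (liftRange short low h (reverse (turn q R)))

  ladderFork₅ : ∀ h j q → let R = suc (suc j * 2) + suc j * 2 in t ≡ R + suc (suc q) →
             Fork t 1 (suc j * 2 + (suc (j * 2) + suc q)) (suc h * t + R)
  ladderFork₅ h j q eq =
      fork (liftLadder (suc h) 0 (suc j * 2))
      (link (short two) (up (next (j * 2))) odds (liftRange short low h (turn q R)))
      (ladders h {suc (suc j * 2)} {suc j * 2} R (suc (suc q)) (excess refl) refl eq) refl refl
    where
    R = suc (suc j * 2) + suc j * 2
    odds : Route (Long t) 1 (affine 1 (suc (j * 2)))
        (rect (suc h) (map (affine 1) (range 0 (suc j * 2)))) 0 (suc (j * 2))
    odds = to (cong (λ d → at d (suc h) (affine 1 (suc (j * 2)))) (opposite^-even j low))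
        (liftLadder (suc h) 1 (suc (j * 2)))
    next : ∀ j → 2 + (1 + suc j * 2) ≡ suc (suc (suc j)) + suc (suc j)
    next = solve-∀

  ladderFork₅′ : ∀ h j → let R = suc (suc j * 2) + suc j * 2 in t ≡ R + 1 →
              Fork t 1 (suc j * 2 + (suc (j * 2) + 1)) (suc (suc h * t + R))
  ladderFork₅′ h j eq =
      fork (link (short one) (up (last (suc h * t) (j * 2))) evens (single (suc h * t + R)))
      (link (short two) (up (next (j * 2))) odds (liftRange short low h (single R)))
      perm refl (cong (_+ (suc (j * 2) + 1)) (+-identityʳ (suc j * 2)))
    where
    R = suc (suc j * 2) + suc j * 2
    evens : Route (Long t) 0 (suc h * t + affine 0 (suc j * 2))
        (rect (suc h) (map (affine 0) (range 0 (suc (suc j * 2))))) 0 (suc j * 2)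
    evens = to (cong (λ d → at d (suc h) (affine 0 (suc j * 2))) (opposite^-even j high))
        (liftLadder (suc h) 0 (suc j * 2))
    odds : Route (Long t) 1 (affine 1 (suc (j * 2)))
        (rect (suc h) (map (affine 1) (range 0 (suc j * 2)))) 0 (suc (j * 2))
    odds = to (cong (λ d → at d (suc h) (affine 1 (suc (j * 2)))) (opposite^-even j low))
        (liftLadder (suc h) 1 (suc (j * 2)))
    next : ∀ j → 2 + (1 + suc j * 2) ≡ suc (suc (suc j)) + suc (suc j)
    next = solve-∀
    last : ∀ z j → 1 + (z + suc (suc j) * 2) ≡ z + (suc (suc (suc j)) + suc (suc j))
    last = solve-∀
    E = rect (suc h) (map (affine 0) (range 0 (suc (suc j * 2))))
    O = rect (suc h) (map (affine 1) (range 0 (suc j * 2)))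
    perm : (E ++ (suc h * t + R ∷ [])) ++ (O ++ rect h (R ∷ [])) ↭ range 0 (suc (suc h * t + R))
    perm = ↭-trans
        (permute 4 (λ a b c d → (a ⊕ b) ⊕ (c ⊕ d) ⊜ (a ⊕ (c ⊕ d)) ⊕ b) ↭-refl E
        (suc h * t + R ∷ []) O (rect h (R ∷ [])))
      (↭-trans (++⁺ʳ _ (ladders h {suc (suc j * 2)} {suc j * 2} R 1 (excess refl) refl eq))
          (↭-reflexive (range-snoc₀ (suc h * t + R))))

-- The general case

-- R < w is expressed by the positive number M + 1 of short columns.
data Division (w : ℕ) : ℕ → Set where
  division : ∀ h R M → w ≡ R + suc M → Division w (R + h * w)

divide : ∀ w .{{_ : NonZero w}} c → Division w c
divide w c with c divMod w
... | result h r refl with m≤n⇒∃[o]m+o≡n (toℕ<n r)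
...   | M , p = division h (toℕ r) M (trans (sym p) (sym (+-suc (toℕ r) M)))

recast : ∀ {t a b b′ c c′} → b ≡ b′ → c ≡ c′ → Realizable t a b c → Realizable t a b′ c′
recast refl refl r = r

slack : ∀ R M {b} → (R + suc M) * 2 ≤ suc (suc b) → ∃[ k ] k + ((R + M) + (R + M)) ≡ b
slack R M p with m≤n⇒∃[o]m+o≡n p
... | k , q = k , suc-injective (suc-injective (trans (shift k R M) q))
  where
  shift : ∀ k R M → suc (suc (k + ((R + M) + (R + M)))) ≡ (R + suc M) * 2 + k
  shift = solve-∀

realizable₁ : ∀ s .{{_ : NonZero s}} b c → s * 2 ≤ suc (suc b) → Realizable (s * 2) 1 b c
realizable₁ s b c p with parity c
... | twice y with divide s y
...   | division h R M refl with slack R M p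
...     | k , q = recast q (double-+ (R + h * s)) (singleOne-even h (parity R) (parity M) k)
realizable₁ s b c p | suc-twice y with divide s y
...   | division h R M refl with slack R M p
...     | k , q = recast q (cong suc (double-+ (R + h * s))) (singleOne-odd h (parity R) (parity M) k)

-- Joining a fork uses one of the two edges of length 1, which leaves one turn. A block with a
-- single column needs none; if both blocks are wider, `tightPath` applies. The `suc` in the number
-- of edges of length t is the edge from 0 to t.
twoOnes-tight : ∀ h R M {t b} → t ≡ R + suc M → t ≡ suc (suc (suc b)) →
    Realizable t 2 b (suc (R + h * t))
twoOnes-tight h zero M {t} {b} _ q =
    realizeFork 0 (Blocks.blockFork₀ t h (some 0 b) q) refl
    (trans (cong (λ u → suc (u + h * t)) q) (size b (h * t)))
  where
  size : ∀ b z → suc (suc (suc (suc b)) + z) ≡ 2 + b + suc z + 1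
  size = solve-∀
twoOnes-tight h (suc zero) zero refl ()
twoOnes-tight h (suc zero) (suc M) {t} {b} p q =
    realizeFork 0 (Blocks.blockFork t h none (some 0 M) p) (trans (+-identityʳ M) M≡b)
    (trans (cong (λ u → suc (u + h * t + 1)) q) (size b (h * t)))
  where
  M≡b : M ≡ b
  M≡b = suc-injective (suc-injective (suc-injective (trans (sym p) q)))
  size : ∀ b z → suc (suc (suc (suc b)) + z + 1) ≡ 2 + b + suc (1 + z) + 1
  size = solve-∀
twoOnes-tight h (suc (suc R)) zero {t} {b} p q =
    realizeFork 0 (Blocks.blockFork t h (some 0 R) none p) R≡b
    (trans (cong (λ u → suc (u + h * t + suc (suc R))) q) (size b R (h * t)))
  where
  R≡b : R ≡ b
  R≡b = suc-injective
      (suc-injective (suc-injective (trans (+-comm 1 (suc (suc R))) (trans (sym p) q))))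
  size : ∀ b R z → suc (suc (suc (suc b)) + z + suc (suc R)) ≡ 2 + b + suc (suc (suc R) + z) + 1
  size = solve-∀
twoOnes-tight h (suc (suc R)) (suc M) {t} {b} p q =
    realize (Blocks.tightPath t h R M p) twos
    (trans (cong (λ u → suc (u + h * t + suc (suc R))) q) (size b R (h * t)))
  where
  twos : M + suc R ≡ b
  twos = suc-injective (suc-injective (suc-injective (trans (shift M R) (trans (sym p) q))))
    where
    shift : ∀ M R → suc (suc (suc (M + suc R))) ≡ suc (suc R) + suc (suc M)
    shift = solve-∀
  size : ∀ b R z → suc (suc (suc (suc b)) + z + suc (suc R)) ≡ 2 + b + suc (suc (suc R) + z) + 1
  size = solve-∀

-- In rows of width t there are 2 R + 1 tall columns, so the parity of R decides whether the even or
-- the odd columns include an even number of tall ones. For R = 0 the extra edge is the one from 0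
-- to t in `blockFork₀`.
twoOnes-odd : ∀ h {R} M → Parity R → 2 ≤ R + suc M → let s = R + suc M; y = R + h * s in
          ∀ k → Realizable (s * 2) 2 (k + ((R + M) + (R + M))) (suc (y + y))
twoOnes-odd h zero (twice zero) (s≤s ()) k
twoOnes-odd h (suc M) (twice zero) _ k =
    realizeFork (suc k) (Blocks.blockFork₀ _ h (some 0 (suc (M * 2))) refl) (twos k M) (size k M h)
  where
  twos : ∀ k M → suc (k + suc (M * 2)) ≡ k + (suc M + suc M)
  twos = solve-∀
  size : ∀ k M h → suc k + suc (suc h * ((2 + M) * 2)) ≡
      2 + (k + (suc M + suc M)) + suc (h * (2 + M) + h * (2 + M)) + 1
  size = solve-∀
twoOnes-odd h zero (twice (suc j)) _ k =
  realizeFork k (Blocks.ladderFork₅′ _ h j (width (j * 2))) (twos k (j * 2)) (size k (j * 2) h)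
  where
  width : ∀ j → suc (suc (suc (suc ((j + 1) * 2)))) ≡ suc (suc (suc j)) + suc (suc j) + 1
  width = solve-∀
  twos : ∀ k j → k + (suc (suc j) + (suc j + 1)) ≡ k + ((suc (suc j) + 0) + (suc (suc j) + 0))
  twos = solve-∀
  size : ∀ k j h → let R = suc (suc j); s = R + 1; y = R + h * s in
         k + suc (suc h * (s * 2) + (suc R + R)) ≡ 2 + (k + ((R + 0) + (R + 0))) + suc (y + y) + 1
  size = solve-∀
twoOnes-odd h (suc M) (twice (suc j)) _ k =
  realizeFork (suc k) (Blocks.ladderFork₅ _ h j (suc (M * 2)) (width (j * 2) M)) (twos k (j * 2) M)
      (size k (j * 2) M h)
  where
  width : ∀ j M → suc (suc (suc (suc ((j + suc (suc M)) * 2)))) ≡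
      suc (suc (suc j)) + suc (suc j) + suc (suc (suc (M * 2)))
  width = solve-∀
  twos : ∀ k j M → suc (k + (suc (suc j) + (suc j + suc (suc (M * 2))))) ≡
      k + ((suc (suc j) + suc M) + (suc (suc j) + suc M))
  twos = solve-∀
  size : ∀ k j M h → let R = suc (suc j); s = R + suc (suc M); y = R + h * s in
         suc k + (suc h * (s * 2) + (suc R + R)) ≡
             2 + (k + ((R + suc M) + (R + suc M))) + suc (y + y) + 1
  size = solve-∀
twoOnes-odd h M (suc-twice j) _ k =
  realizeFork (suc k) (Blocks.ladderFork₃ _ h j (M * 2) (width (j * 2) M)) (twos k (j * 2) M)
      (size k (j * 2) M h)
  where
  width : ∀ j M → suc (suc ((j + suc M) * 2)) ≡ suc (suc j) + suc j + suc (M * 2)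
  width = solve-∀
  twos : ∀ k j M → suc (k + (suc j + M * 2 + j)) ≡ k + ((suc j + M) + (suc j + M))
  twos = solve-∀
  size : ∀ k j M h → let R = suc j; s = R + suc M; y = R + h * s in
         suc k + (suc h * (s * 2) + (suc R + R)) ≡ 2 + (k + ((R + M) + (R + M))) + suc (y + y) + 1
  size = solve-∀

twoOnes-loose : ∀ s .{{_ : NonZero s}} b c → 2 ≤ s → s * 2 ≤ suc (suc b) → Realizable (s * 2) 2 b c
twoOnes-loose s b c 2≤s p with parity c
... | twice y with divide s y
...   | division h R M refl with slack R M p
...     | k , q = recast q (double-+ (R + h * s)) (twoOnes-even h (parity R) (parity M) k)
twoOnes-loose s b c 2≤s p | suc-twice y with divide s y
...   | division h R M refl with slack R M p
...     | k , q = recast q (cong suc (double-+ (R + h * s))) (twoOnes-odd h M (parity R) 2≤s k)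

realizable₂ : ∀ s .{{_ : NonZero s}} b c → 2 ≤ s → s * 2 ≤ suc (suc (suc b)) →
    Realizable (s * 2) 2 b (suc c)
realizable₂ s b c 2≤s p with s * 2 ≤? suc (suc b)
... | yes p′ = twoOnes-loose s b (suc c) 2≤s p′
realizable₂ (suc s) b c 2≤s p | no ¬p with divide (suc s * 2) c
... | division h R M q = twoOnes-tight h R M q (≤-antisym p (≰⇒> ¬p))

record Split (m n x y : ℕ) : Set where
  constructor splitting
  field
    p q p′ q′ : ℕ
    left   : p + q ≡ m
    right  : p′ + q′ ≡ n
    first  : p′ + p ≡ x
    second : q′ + q ≡ y

-- Greedy: the part of size m takes as much of x as it can.
split : ∀ m n x y → m + n ≡ x + y → Split m n x y
split zero    n x       y eq   = splitting 0 0 x y refl (sym eq) (+-identityʳ x) (+-identityʳ y)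
split (suc m) n zero    y eq   =
    splitting 0 (suc m) 0 n refl refl refl (trans (+-comm n (suc m)) eq)
split (suc m) n (suc x) y eq =
  let splitting p q p′ q′ l r f g = split m n x y (suc-injective eq) in
  splitting (suc p) q p′ q′ (cong suc l) r (trans (+-suc p′ p) (cong suc f)) g

recountFork : ∀ {t a a′ b b′ v} → Fork t a b v → a ≡ a′ → b ≡ b′ → Fork t a′ b′ v
recountFork f refl refl = f

-- Two edges of length 1 are reserved for the turns of the two blocks and `split` distributes the
-- rest. A single column needs no turn, so then the other block takes everything.
blocks : ∀ h R M {t} a b → t ≡ suc R + suc M → suc (suc a) + b ≡ R + M →
    Fork t (suc (suc a)) b (suc (suc h * t + suc R))
blocks h zero M {t} a b p refl =
    recountFork (Blocks.blockFork t h none (some (suc a) b) p) (+-identityʳ _) (+-identityʳ b)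
blocks h (suc R) zero {t} a b p q with trans (sym (+-identityʳ R)) (sym (suc-injective q))
... | refl = Blocks.blockFork t h (some (suc a) b) none p
blocks h (suc R) (suc M) {t} a b p q with split R M a b
    (sym (suc-injective (suc-injective (trans q (cong suc (+-suc R M))))))
... | splitting p₁ q₁ p₂ q₂ refl refl refl refl =
  recountFork (Blocks.blockFork t h (some p₁ q₁) (some p₂ q₂) p) (cong suc (+-suc p₂ p₁)) refl

-- Here b is the least number of edges of length 2, with a + b = t - 1 for the actual counts; `grow`
-- absorbs the other k.
middle : ∀ h R M {t} a b k → t ≡ R + suc M → t ≡ suc (suc (suc (suc a))) + b →
    Realizable t (suc (suc (suc a))) (k + b) (suc (R + h * t))
middle h zero M {t} a b k p q = realizeFork k (Blocks.blockFork₀ t h (some (suc a) b) q) refl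
    (trans (cong (λ u → k + suc (u + h * t)) q) (size k a b (h * t)))
  where
  size : ∀ k a b z → k + suc (suc (suc (suc (suc a))) + b + z) ≡
      suc (suc (suc a)) + (k + b) + suc z + 1
  size = solve-∀
middle h (suc R) M {t} a b k p q =
    realizeFork k
    (blocks h R M a b p
    (sym (suc-injective (suc-injective (trans (sym (trans p (cong suc (+-suc R M)))) q))))) refl
  (trans (cong (λ u → k + suc (u + h * t + suc R)) q) (size k a b R (h * t)))
  where
  size : ∀ k a b R z → k + suc (suc (suc (suc (suc a))) + b + z + suc R) ≡
      suc (suc (suc a)) + (k + b) + suc (suc R + z) + 1
  size = solve-∀

lengthen : ∀ e {s x y} → Standard s x y → Standard s (e + x) y
lengthen zero    r = r
lengthen (suc e) r = standard-prefix (lengthen e r)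

-- The grid has width t itself and uses only the lengths 1 and t. Joining adds one edge of length 1,
-- and all b edges of length 2 are inserted by `grow`.
manyOnes : ∀ {t x y} b → Standard t x y → Realizable t (suc x) b y
manyOnes {x = x} {y} b (standard r) = realizeFork b (isolate (widen Scaled⊆Long r)) (+-identityʳ b)
    (size b x y)
  where
  size : ∀ b x y → b + suc (suc (x + y)) ≡ suc x + b + y + 1
  size = solve-∀

-- The width is even, so the numbers of tall and short columns have the same parity and one of the
-- two staircases fits.
standardDouble : ∀ s .{{_ : NonZero s}} c → ∃[ x ] suc x ≡ s * 2 × Standard (s * 2) x c
standardDouble s c with parity c
... | twice y with divide s y
...   | division h R M refl = _ , shift R M , standard-even h R (suc (M * 2)) (width R M) (tees R h s)
  where
  shift : ∀ R M → suc (R * 2 + suc (M * 2)) ≡ (R + suc M) * 2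
  shift = solve-∀
  width : ∀ R M → (R + suc M) * 2 ≡ R * 2 + suc (suc (M * 2))
  width = solve-∀
  tees : ∀ R h s → (R + h * s) * 2 ≡ R * 2 + h * (s * 2)
  tees = solve-∀
standardDouble s c | suc-twice y with divide s y
...   | division h R M refl = _ , shift R M , standard-odd h R M (width R M) (tees R h s)
  where
  shift : ∀ R M → suc (R * 2 + suc (M * 2)) ≡ (R + suc M) * 2
  shift = solve-∀
  width : ∀ R M → (R + suc M) * 2 ≡ suc (R * 2) + suc (M * 2)
  width = solve-∀
  tees : ∀ R h s → suc ((R + h * s) * 2) ≡ suc (R * 2) + h * (s * 2)
  tees = solve-∀

realizable₃ : ∀ s .{{_ : NonZero s}} a b c → s * 2 ≤ suc (suc (suc (suc a)) + b) →
    Realizable (s * 2) (suc (suc (suc a))) b (suc c)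
realizable₃ s a b c p with s * 2 ≤? suc (suc (suc a))
... | yes t≤a with m≤n⇒∃[o]m+o≡n t≤a | standardDouble s (suc c)
...   | e , q | x , w , S =
  subst (λ a → Realizable (s * 2) a b (suc c))
    (trans (trans (sym (+-suc e x)) (cong (e +_) w)) (trans (+-comm e (s * 2)) q))
    (manyOnes b (lengthen e S))
realizable₃ (suc s) a b c p | no ¬p with m≤n⇒∃[o]m+o≡n (≰⇒> ¬p) | divide (suc s * 2) c
... | o , q | division h R M w with m≤n⇒∃[o]m+o≡n
  (+-cancelˡ-≤ (suc (suc (suc (suc a)))) o b (subst (_≤ suc (suc (suc (suc a)) + b)) (sym q) p))
...   | k , refl = recast (+-comm k o) refl (middle h R M a o k w (sym q))

realizable : ∀ s a b c → 2 ≤ s → 1 ≤ a → 1 ≤ c → s * 2 ≤ suc (a + b) → Realizable (s * 2) a b c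
realizable (suc s) (suc zero)          b (suc c) 2≤s _ _ p = realizable₁ (suc s) b (suc c) p
realizable (suc s) (suc (suc zero))    b (suc c) 2≤s _ _ p = realizable₂ (suc s) b c 2≤s p
realizable (suc s) (suc (suc (suc a))) b (suc c) 2≤s _ _ p = realizable₃ (suc s) a b c p

-- From routes to Hamiltonian paths

gaps : ∀ {D x y a b} → Walk D x y a b → List ℕ
gaps (stop _)             = []
gaps (step {d = d} _ _ w) = d ∷ gaps w

length-verts : ∀ {D x y a b} (w : Walk D x y a b) → length (verts w) ≡ suc (length (gaps w))
length-verts (stop _)     = refl
length-verts (step _ _ w) = cong suc (length-verts w)

gaps-↭ : ∀ {t x y a b} (w : Walk (Long t) x y a b) → ∃[ c ] gaps w ↭ multiset12t t a b c
gaps-↭ (stop _) = 0 , ↭-refl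
gaps-↭ (step (short one) _ w) = let c , p = gaps-↭ w in c , prep 1 p
gaps-↭ (step {a′ = a} (short two) _ w) =
  let c , p = gaps-↭ w in c , ↭-trans (prep 2 p) (↭-sym (↭-shift 2 (replicate a 1) _))
gaps-↭ {t} (step {a′ = a} {b} tee _ w) =
  let c , p = gaps-↭ w in suc c , ↭-trans (prep t p) (↭-sym
    (↭-trans (↭-sym (++-assoc (replicate a 1) (replicate b 2) _))
      (↭-trans (↭-shift t (replicate a 1 ++ replicate b 2) _)
        (prep t (++-assoc (replicate a 1) (replicate b 2) _)))))

length-multiset : ∀ t a b c → length (multiset12t t a b c) ≡ a + b + c
length-multiset t a b c =
  trans (length-++ (replicate a 1))
    (trans (cong₂ _+_ (length-replicate a)
        (trans (length-++ (replicate b 2)) (cong₂ _+_ (length-replicate b) (length-replicate c))))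
      (sym (+-assoc a b c)))

range-bounds : ∀ k n → All (λ x → k ≤ x × x < n + k) (range k n)
range-bounds k zero    = []
range-bounds k (suc n) = (≤-refl , s≤s (m≤n+m k n)) ∷
  All.map (λ {x} (p , q) → <⇒≤ p , subst (x <_) (+-suc n k) q) (range-bounds (suc k) n)

range-unique : ∀ k n → Unique (range k n)
range-unique k zero    = []
range-unique k (suc n) =
  All.map (λ (p , _) → <⇒≢ p) (range-bounds (suc k) n) ∷ range-unique (suc k) n

∈-range : ∀ k n {x} → k ≤ x → x < n + k → x ∈ range k n
∈-range k zero    p q = ⊥-elim (<⇒≱ q p)
∈-range k (suc n) {x} p q with k ≟ x
... | yes refl = here refl
... | no k≢x   = there (∈-range (suc k) n (≤∧≢⇒< p k≢x) (subst (x <_) (sym (+-suc n k)) q))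

fins : ∀ {v xs} → All (_< v) xs → List (Fin v)
fins []       = []
fins (p ∷ ps) = fromℕ< p ∷ fins ps

toℕ-fins : ∀ {v xs} (ps : All (_< v) xs) → map toℕ (fins ps) ≡ xs
toℕ-fins []       = refl
toℕ-fins (p ∷ ps) = cong₂ _∷_ (toℕ-fromℕ< p) (toℕ-fins ps)

∣-∣-Adj : ∀ {d x y} → Adj d x y → ∣ x - y ∣ ≡ d
∣-∣-Adj {d} {x} (up refl)       = trans (cong (∣ x -_∣) (+-comm d x)) (∣m-m+n∣≡n x d)
∣-∣-Adj {d} {y = y} (down refl) = trans (∣-∣-comm (d + y) y) (∣-∣-Adj {d} {y} (up refl))

-- As d is at most half of v, it is the smaller of d and v - d.
edgeLength-Adj : ∀ {v d} (x y : Fin v) → Adj d (toℕ x) (toℕ y) → d + d ≤ v → edgeLength x y ≡ d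
edgeLength-Adj {v} x y p q rewrite ∣-∣-Adj p = m≤n⇒m⊓n≡m (m+n≤o⇒m≤o∸n _ q)

Long-≤ : ∀ {t d a b} → 2 ≤ t → Long t d a b → d ≤ t
Long-≤ 2≤t (short one) = <⇒≤ 2≤t
Long-≤ 2≤t (short two) = 2≤t
Long-≤ 2≤t tee         = ≤-refl

pathLengths : ∀ {v} → List (Fin v) → List ℕ
pathLengths xs = map (uncurry edgeLength) (zip xs (drop 1 xs))

verts-≢[] : ∀ {D x y a b} (w : Walk D x y a b) → ¬ ([] ≡ verts w)
verts-≢[] (stop _)     ()
verts-≢[] (step _ _ _) ()

verts-head : ∀ {D x y a b z zs} (w : Walk D x y a b) → z ∷ zs ≡ verts w → z ≡ x
verts-head (stop _)     = ∷-injectiveˡ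
verts-head (step _ _ _) = ∷-injectiveˡ

-- Allowing any `fs` with the right image avoids recursion on the bounds from which `fins` is built.
pathLengths-gaps : ∀ {t v x y a b} → 2 ≤ t → t + t ≤ v →
    (w : Walk (Long t) x y a b) (fs : List (Fin v)) →
                   map toℕ fs ≡ verts w → pathLengths fs ≡ gaps w
pathLengths-gaps 2≤t t+t≤v w            []           eq = ⊥-elim (verts-≢[] w eq)
pathLengths-gaps 2≤t t+t≤v (stop _)     (f ∷ [])     eq = refl
pathLengths-gaps 2≤t t+t≤v (stop _)     (f ∷ g ∷ fs) ()
pathLengths-gaps 2≤t t+t≤v (step e p w) (f ∷ [])     eq = ⊥-elim (verts-≢[] w (∷-injectiveʳ eq))
pathLengths-gaps 2≤t t+t≤v (step e p w) (f ∷ g ∷ fs) eq = cong₂ _∷_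
  (edgeLength-Adj f g
      (subst₂ (Adj _) (sym (∷-injectiveˡ eq)) (sym (verts-head w (∷-injectiveʳ eq))) p)
    (≤-trans (+-mono-≤ (Long-≤ 2≤t e) (Long-≤ 2≤t e)) t+t≤v))
  (pathLengths-gaps 2≤t t+t≤v w (g ∷ fs) (∷-injectiveʳ eq))

hamiltonian : ∀ {t a b c} → 2 ≤ t → let v = a + b + c + 1 in t + t ≤ v → Realizable t a b c →
              ∃[ H ] lengths {v} H ↭ multiset12t t a b c
hamiltonian {t} {a} {b} {c} 2≤t t+t≤v (path (route w p)) =
    H , ↭-trans (↭-reflexive (pathLengths-gaps 2≤t t+t≤v w (fins bounded) (toℕ-fins bounded))) gaps↭
  where
  v = a + b + c + 1
  bounded : All (_< v) (verts w)
  bounded =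
      All-resp-↭ (↭-sym p)
      (All.map (λ {x} (_ , q) → subst (x <_) (+-identityʳ v) q) (range-bounds 0 v))
  spanned : ∀ x → x ∈ fins bounded
  spanned x with ∈-map⁻ toℕ (subst (toℕ x ∈_) (sym (toℕ-fins bounded)) (∈-resp-↭ (↭-sym p)
    (∈-range 0 v z≤n (subst (toℕ x <_) (sym (+-identityʳ v)) (toℕ<n x)))))
  ... | y , y∈ , eq = subst (_∈ fins bounded) (sym (toℕ-injective eq)) y∈
  H : HamiltonianPath v
  H = record
    { vertices = fins bounded
    ; unique   =
        Unique.map⁻
        (subst Unique (sym (toℕ-fins bounded))
        (Unique-resp-↭ (setoid ℕ) (↭⇒↭ₛ (↭-sym p)) (range-unique 0 v)))
    ; spanning = spanned
    }
  gaps↭ : gaps w ↭ multiset12t t a b c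
  gaps↭ with gaps-↭ w
  ... | c′ , q = subst (λ c → gaps w ↭ multiset12t t a b c) c′≡c q
    where
    c′≡c : c′ ≡ c
    -- The v vertices give v - 1 edges in all, which determines the number of edges of length t.
    c′≡c = +-cancelˡ-≡ (a + b) c′ c
        (suc-injective (trans (cong suc (trans (sym (length-multiset t a b c′)) (sym (↭-length q))))
      (trans (sym (length-verts w))
          (trans (↭-length p) (trans (length-range 0 v) (+-comm (a + b + c) 1))))))

-- The divisor condition

multiples : ℕ → List ℕ → ℕ
multiples d xs = length (filter (d ∣?_) xs)

multiples-++ : ∀ d xs ys → multiples d (xs ++ ys) ≡ multiples d xs + multiples d ys
multiples-++ d xs ys = trans (cong length (filter-++ (d ∣?_) xs ys)) (length-++ (filter (d ∣?_) xs))

multiples-≤ : ∀ d n x → multiples d (replicate n x) ≤ n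
multiples-≤ d n x =
    ≤-trans (length-filter (d ∣?_) (replicate n x)) (≤-reflexive (length-replicate n))

multiples-∤ : ∀ {d x} n → ¬ (d ∣ x) → multiples d (replicate n x) ≡ 0
multiples-∤ {d} n d∤x = cong length (filter-none (d ∣?_) (All.replicate⁺ n d∤x))

divisorCondition : ∀ t a b c → 2 ≤ t → 1 ≤ a → t ≤ a + b + 1 →
    DivisorCondition (a + b + c + 1) (multiset12t t a b c)
divisorCondition t a b c 2≤t 1≤a t≤a+b+1 d d∣v =
    m+n≤o⇒m≤o∸n _ (≤-trans (+-monoˡ-≤ d (≤-reflexive total)) (bound d d∣v))
  where
  open ≤-Reasoning
  ones twos tees : ℕ → ℕ
  ones d = multiples d (replicate a 1)
  twos d = multiples d (replicate b 2)
  tees d = multiples d (replicate c t)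

  total : multiples d (multiset12t t a b c) ≡ ones d + (twos d + tees d)
  total = trans (multiples-++ d (replicate a 1) _)
      (cong (ones d +_) (multiples-++ d (replicate b 2) _))

  -- The multiset has v - 1 elements altogether, which suffices for d ≤ 1.
  bound-small : ∀ d → d ≤ 1 → ones d + (twos d + tees d) + d ≤ a + b + c + 1
  bound-small d d≤1 = begin
    ones d + (twos d + tees d) + d ≤⟨ +-mono-≤
        (+-mono-≤ (multiples-≤ d a 1) (+-mono-≤ (multiples-≤ d b 2) (multiples-≤ d c t))) d≤1 ⟩
    a + (b + c) + 1                ≡⟨ cong (_+ 1) (+-assoc a b c) ⟨
    a + b + c + 1                  ∎

  bound : ∀ d → d ∣ a + b + c + 1 → ones d + (twos d + tees d) + d ≤ a + b + c + 1
  bound 0 _ = bound-small 0 z≤n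
  bound 1 _ = bound-small 1 ≤-refl
  bound 2 _ = begin
    ones 2 + (twos 2 + tees 2) + 2 ≤⟨ +-monoˡ-≤ 2
        (+-mono-≤ (≤-reflexive (multiples-∤ {2} a (>⇒∤ (s≤s (s≤s z≤n)))))
        (+-mono-≤ (multiples-≤ 2 b 2) (multiples-≤ 2 c t))) ⟩
    b + c + 2                      ≡⟨ rearrange b c ⟩
    1 + (b + c) + 1                ≤⟨ +-monoˡ-≤ 1 (+-monoˡ-≤ (b + c) 1≤a) ⟩
    a + (b + c) + 1                ≡⟨ cong (_+ 1) (+-assoc a b c) ⟨
    a + b + c + 1                  ∎
    where
    rearrange : ∀ b c → b + c + 2 ≡ 1 + (b + c) + 1
    rearrange = solve-∀
  bound d@(suc (suc (suc _))) d∣v with d ∣? t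
  ... | yes d∣t = begin
    ones d + (twos d + tees d) + d ≤⟨ +-mono-≤
        (+-mono-≤ (≤-reflexive (multiples-∤ {d} a (>⇒∤ (s≤s (s≤s z≤n)))))
        (+-mono-≤ (≤-reflexive (multiples-∤ {d} b (>⇒∤ (s≤s (s≤s (s≤s z≤n))))))
        (multiples-≤ d c t)))
                                        (≤-trans (∣⇒≤ {{>-nonZero (≤-trans (s≤s z≤n) 2≤t)}} d∣t)
                                            t≤a+b+1) ⟩
    c + (a + b + 1)                ≡⟨ rearrange a b c ⟩
    a + b + c + 1                  ∎
    where
    rearrange : ∀ a b c → c + (a + b + 1) ≡ a + b + c + 1
    rearrange = solve-∀
  -- No element is a multiple of d, and d ≤ v.
  ... | no d∤t = begin
    ones d + (twos d + tees d) + d ≡⟨ cong (_+ d)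
        (cong₂ _+_ (multiples-∤ {d} a d∤1)
        (cong₂ _+_ (multiples-∤ {d} b d∤2) (multiples-∤ {d} c d∤t))) ⟩
    d                              ≤⟨ ∣⇒≤ {{>-nonZero (m≤n+m 1 (a + b + c))}} d∣v ⟩
    a + b + c + 1                  ∎
    where
    d∤1 = >⇒∤ (s≤s (s≤s z≤n))
    d∤2 = >⇒∤ (s≤s (s≤s (s≤s z≤n)))

theorem1p5 : ∀ (t a b c : ℕ) → 4 ≤ t → 2 ∣ t →
    1 ≤ a → 1 ≤ b → 1 ≤ c → t ∸ 1 ≤ a + b →
    let v = a + b + c + 1
        L = multiset12t t a b c
    in t ≤ ⌊ v /2⌋ →
       (∃[ H ] lengths {v} H ↭ L) ⇔ DivisorCondition v L
theorem1p5 t@_ a b c 4≤t (divides s refl) 1≤a _ 1≤c t-1≤a+b t≤⌊v/2⌋ = mk⇔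
  (λ _ → divisorCondition t a b c 2≤t 1≤a (≤-trans t≤1+a+b (≤-reflexive (+-comm 1 (a + b)))))
  (λ _ → hamiltonian 2≤t t+t≤v (realizable s a b c (*-cancelʳ-≤ 2 s 2 4≤t) 1≤a 1≤c t≤1+a+b))
  where
  v = a + b + c + 1
  2≤t : 2 ≤ t
  2≤t = ≤-trans (s≤s (s≤s z≤n)) 4≤t
  t≤1+a+b : t ≤ suc (a + b)
  t≤1+a+b = ≤-trans (m≤n+m∸n t 1) (s≤s t-1≤a+b)
  t+t≤v : t + t ≤ v
  t+t≤v = ≤-trans (+-mono-≤ t≤⌊v/2⌋ (≤-trans t≤⌊v/2⌋ (⌊n/2⌋≤⌈n/2⌉ v)))
      (≤-reflexive (⌊n/2⌋+⌈n/2⌉≡n v))
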